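{- There exists a positive real $r_0$ such that the following holds for every positive integer $r$ and positive real $\alpha\le1$ with $(\log r)^\alpha\ge r_0$. For $n=2^{(\log r)^{2+\alpha}/200}$, there exists a partition $E=E_1\cup\dots\cup E_{\sqrt r}$ of the edge set of the complete graph $K_n$ such that \[ \chi(\mathcal{G}_I)\le 2^{3(\log r)^{\alpha/2}\sqrt{|I|\log 2|I|}} \] for all $I\subseteq[\sqrt r]$.
   Context: Logarithms are base 2; non-integer quantities such as $n$ and $\sqrt r$ are understood rounded to integers (the paper omits floor and ceiling signs), and some parts $E_i$ may be empty. For $I\subseteq[\sqrt r]$, $\mathcal{G}_I$ is the spanning subgraph of $K_n$ with edge set $\bigcup_{i\in I}E_i$; $\chi$ is chromatic number. -}

module Defs where

open import Level using (0ℓ)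
open import Data.Nat as ℕ using (ℕ; suc; NonZero)
open import Data.Integer as ℤ using (+_)
open import Data.Rational as ℚ
  using (ℚ; 0ℚ; 1ℚ; ↥_; ↧ₙ_; _≤_; _<_; _+_; _*_; +-*-rawSemiring)
open import Algebra.Definitions.RawSemiring +-*-rawSemiring using (_^_)
open import Data.Fin using (Fin)
open import Data.Fin.Subset using (Subset; _∈_)
open import Data.Product using (_×_; _,_; ∃-syntax; Σ-syntax)
open import Data.Sum using (_⊎_)
open import Function using (_⇔_)
open import Relation.Nullary using (¬_)
open import Relation.Binary using (Rel; Symmetric; Irreflexive)
open import Relation.Binary.PropositionalEquality using (_≡_; _≢_; ≢-sym)

-- Real numbers are Dedekind cuts: L x q means q < x and U x q means x < q.
-- A Cut is the bare pair of predicates; IsReal adds the cut axioms.  The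
-- arithmetic operations below act on the bare predicates, so that they are
-- total; the domain on which each agrees with the real operation is stated
-- with it.

record Cut : Set₁ where
  field
    L U : ℚ → Set

open Cut public

record IsReal (x : Cut) : Set where
  field
    L-inhabited : ∃[ q ] L x q
    U-inhabited : ∃[ q ] U x q
    L-rounded   : ∀ q → L x q ⇔ (∃[ s ] (q < s × L x s))
    U-rounded   : ∀ q → U x q ⇔ (∃[ s ] (s < q × U x s))
    disjoint    : ∀ q → ¬ (L x q × U x q)
    located     : ∀ q s → q < s → L x q ⊎ U x s

infix 4 _≤ʳ_ _<ʳ_

_≤ʳ_ : Cut → Cut → Set
x ≤ʳ y = ∀ q → L x q → L y q

_<ʳ_ : Cut → Cut → Set
x <ʳ y = ∃[ q ] (U x q × L y q)

ℕ→ℚ : ℕ → ℚ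
ℕ→ℚ m = + m ℚ./ 1

fromℕ : ℕ → Cut
L (fromℕ m) q = q < ℕ→ℚ m
U (fromℕ m) q = ℕ→ℚ m < q

infix  9 √_
infixr 8 _^ʳ_
infixl 7 _*ʳ_ _/ʳ_
infixl 6 _+ʳ_

_+ʳ_ : Cut → Cut → Cut
L (x +ʳ y) q = ∃[ s ] ∃[ t ] (L x s × L y t × q < s + t)
U (x +ʳ y) q = ∃[ s ] ∃[ t ] (U x s × U y t × s + t < q)

-- Product of nonnegative reals.
_*ʳ_ : Cut → Cut → Cut
L (x *ʳ y) q =
  q < 0ℚ ⊎ (∃[ s ] ∃[ t ] (0ℚ ≤ s × 0ℚ ≤ t × L x s × L y t × q < s * t))
U (x *ʳ y) q = ∃[ s ] ∃[ t ] (U x s × U y t × s * t < q)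

_/ʳ_ : Cut → (m : ℕ) → .{{NonZero m}} → Cut
L (x /ʳ m) q = L x (q * ℕ→ℚ m)
U (x /ʳ m) q = U x (q * ℕ→ℚ m)

-- Square root of a nonnegative real.
√_ : Cut → Cut
L (√ x) q = q < 0ℚ ⊎ (0ℚ ≤ q × L x (q * q))
U (√ x) q = 0ℚ < q × U x (q * q)

num : ℚ → ℕ
num p = ℤ.∣ ↥ p ∣

-- Base-2 logarithm of a positive integer: for p = a/b ≥ 0,
-- p < log₂ m iff 2ᵃ < mᵇ.  The same formulas give log₂ 0 = 0.
log₂ : ℕ → Cut
L (log₂ m) p = p < 0ℚ ⊎ (0ℚ ≤ p × 2 ℕ.^ num p ℕ.< m ℕ.^ ↧ₙ p)
U (log₂ m) p = 0ℚ < p × m ℕ.^ ↧ₙ p ℕ.< 2 ℕ.^ num p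

-- x ^ʳ y for x, y ≥ 0 not both 0.  It is approximated by the rational powers
-- s ^ p with p = a/b ≥ 0, and q < s ^ p iff qᵇ < sᵃ.  Since s ^ p increases
-- with p for s ≥ 1 and decreases for s ≤ 1, a lower approximation takes p from
-- below y in the first case and from above y in the second.
_^ʳ_ : Cut → Cut → Cut
L (x ^ʳ y) q = q < 0ℚ ⊎ (0ℚ ≤ q × (∃[ s ] ∃[ p ]
  ( L x s × 0ℚ < s × 0ℚ ≤ p
  × ((1ℚ ≤ s × L y p) ⊎ (s ≤ 1ℚ × U y p))
  × q ^ ↧ₙ p < s ^ num p)))
U (x ^ʳ y) q = 0ℚ < q × (∃[ s ] ∃[ p ]
  ( U x s × 0ℚ < s × 0ℚ ≤ p
  × ((1ℚ ≤ s × U y p) ⊎ (s ≤ 1ℚ × L y p))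
  × s ^ num p < q ^ ↧ₙ p))

IsFloor : Cut → ℕ → Set
IsFloor x n = fromℕ n ≤ʳ x × x <ʳ fromℕ (suc n)

record Graph (n : ℕ) : Set₁ where
  field
    Adj    : Rel (Fin n) 0ℓ
    sym    : Symmetric Adj
    irrefl : Irreflexive _≡_ Adj

open Graph public

K : ∀ n → Graph n
K n = record { Adj = _≢_ ; sym = ≢-sym ; irrefl = λ u≡v u≢v → u≢v u≡v }

-- The edge sets of the (possibly edgeless) graphs E i partition that of G.
record IsEdgePartition {n m : ℕ} (G : Graph n) (E : Fin m → Graph n) : Set where
  field
    sub      : ∀ i {u v} → Adj (E i) u v → Adj G u v
    cover    : ∀ {u v} → Adj G u v → ∃[ i ] Adj (E i) u v
    disjoint : ∀ {i j u v} → Adj (E i) u v → Adj (E j) u v → i ≡ j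

𝒢 : ∀ {n m} → (Fin m → Graph n) → Subset m → Graph n
𝒢 E I = record
  { Adj    = λ u v → ∃[ i ] (i ∈ I × Adj (E i) u v)
  ; sym    = λ (i , i∈I , e) → i , i∈I , sym (E i) e
  ; irrefl = λ u≡v (i , _ , e) → irrefl (E i) u≡v e
  }

Colourable : ∀ {n} → Graph n → ℕ → Set
Colourable {n} G k =
  Σ[ c ∈ (Fin n → Fin k) ] (∀ {u v} → Adj G u v → c u ≢ c v)

IsChromaticNumber : ∀ {n} → Graph n → ℕ → Set
IsChromaticNumber G k = Colourable G k × (∀ j → Colourable G j → k ℕ.≤ j)

infix 4 χ[_]≤_

χ[_]≤_ : ∀ {n} → Graph n → Cut → Set
χ[ G ]≤ x = ∃[ k ] (IsChromaticNumber G k × fromℕ k ≤ʳ x)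

module Submission where

-- Vertices are b-tuples of blocks, each block a word of length T over an alphabet of size m.  An
-- edge gets as colour the first block s in which its ends differ, the first differing position i of
-- that block, the smaller of the two letters there, and the 0/1 vector of all positions where the
-- two blocks differ.  If every set of colours with block s is handled by a colouring of the words
-- of block s, then the product of these b colourings handles I.
--
-- Fix a block, let C be its colours in I, and say that a colour hits the positions marked by its
-- vector.  Colours whose positions are hit by at most D colours split greedily into D classes
-- without mutual hits; in each class the parity of the number of colours whose letter occurs at
-- their position is changed by every edge, which gives 2^D vertex colours.  A word with a colour's
-- letter at a position hit by more than D colours records that colour: words with the same record
-- agree at the position, so all colours hitting it are discarded, and this happens at most |C|/D
-- times.  With k = |I| the total is at most 2^(log(2k) k/D + D b), where D is of order
-- √(k log(2k) / b) and b is at most a constant times (log r)^α.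

open import Defs hiding (sym)
open import Algebra.Bundles using (CommutativeRing)
open import Data.Bool using (Bool; true; false; _∧_; not; _xor_; if_then_else_)
open import Data.Empty using (⊥-elim)
open import Data.Fin as F using (Fin; zero; suc; toℕ; join; combine; remQuot; splitAt; funToFin; finToFun; inject≤)
import Data.Fin.Properties as FP
open import Data.Fin.Subset as Sub using (Subset; inside; outside; ∣_∣)
import Data.Fin.Subset.Properties as SubP
open import Data.Integer as ℤ using (-[1+_])
import Data.Integer.Properties as ℤP
open import Data.List using (List; []; _∷_; filter; length; map; lookup; allFin)
import Data.List.Membership.DecPropositional as DecMembership
open import Data.List.Membership.Propositional using (_∈_; find; lose)
open import Data.List.Membership.Propositional.Properties using (∈-filter⁺; ∈-filter⁻; ∈-map⁺; ∈-map⁻; ∈-allFin)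
import Data.List.Properties as LP
open import Data.List.Relation.Binary.Permutation.Propositional using (↭-sym)
open import Data.List.Relation.Binary.Permutation.Propositional.Properties using (∈-resp-↭; ↭-length)
open import Data.List.Relation.Unary.All as All using (All; []; _∷_)
open import Data.List.Relation.Unary.AllPairs using (AllPairs; []; _∷_)
import Data.List.Relation.Unary.AllPairs.Properties as APP
open import Data.List.Relation.Unary.Any using (Any; here; there; any?; index)
open import Data.List.Relation.Unary.Any.Properties using (lookup-index)
open import Data.List.Relation.Unary.Linked.Properties using (Linked⇒AllPairs)
import Data.List.Sort
open import Data.Nat as ℕ using (ℕ; zero; suc; _+_; _*_; _^_; _≤_; _<_; _≤?_; z≤n; s≤s; NonZero; _≤′_; ≤′-refl; ≤′-step)
import Data.Nat.Coprimality as Coprimality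
open import Data.Nat.DivMod using (_/_; _%_; _mod_; m≡m%n+[m/n]*n; m%n<n; m<n⇒m%n≡m; m/n*n≤m)
import Data.Nat.Properties as ℕP
open import Data.Nat.Tactic.RingSolver using (solve-∀)
open import Data.Product using (_×_; _,_; proj₁; proj₂; Σ-syntax; ∃-syntax; map₂)
open import Data.Rational as ℚ using (ℚ; 0ℚ; 1ℚ; ½; ↧ₙ_; mkℚ; *<*; *≤*)
  renaming (_+_ to _+ℚ_; _*_ to _*ℚ_; _≤_ to _≤ℚ_; _<_ to _<ℚ_)
import Data.Rational.Properties as ℚP
import Data.Rational.Unnormalised as ℚᵘ
import Data.Rational.Unnormalised.Properties as ℚᵘP
open import Data.Sum using (_⊎_; inj₁; inj₂)
open import Data.Sum.Properties using (inj₁-injective; inj₂-injective)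
open import Data.Vec using ([]; _∷_; here; there)
open import Function using (_∘_; mk⇔; Equivalence; it)
open import Level using (0ℓ)
import Relation.Binary.Construct.Flip.EqAndOrd as Flip
import Relation.Binary.Construct.On as On
open import Relation.Binary.Definitions using (DecidableEquality; tri<; tri≈; tri>)
open import Relation.Binary.PropositionalEquality
open import Relation.Nullary using (¬_; Dec; yes; no; does; contradiction; ¬?)
open import Relation.Nullary.Decidable using (_×-dec_; _⊎-dec_; _→-dec_; dec-true; dec-false; does-⇔; map′; from-yes)
open import Relation.Unary using (Pred; Decidable)
open import Algebra.Definitions.RawSemiring ℚ.+-*-rawSemiring using () renaming (_^_ to _^ℚ_)
open import Algebra.Properties.CommutativeMonoid.Sum ℕP.+-0-commutativeMonoid 
  using (sum; sum-cong-≗; sum-replicate-zero; ∑-distrib-+)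
open import Algebra.Properties.CommutativeSemiring.Exp (CommutativeRing.commutativeSemiring ℚP.+-*-commutativeRing)
  using (^-homo-*; ^-assocʳ; ^-distrib-*)
open import Algebra.Properties.Monoid.Sum ℕP.*-1-monoid using () renaming (sum to ∏)

-- Colouring the words of one block

module _ {A : Set} {P : Pred A 0ℓ} (P? : Decidable P) where

  length-filter-∁ : ∀ xs → length (filter P? xs) + length (filter (¬? ∘ P?) xs) ≡ length xs
  length-filter-∁ []       = refl
  length-filter-∁ (x ∷ xs) with P? x
  ... | yes _ = cong suc (length-filter-∁ xs)
  ... | no _  = trans (ℕP.+-suc _ _) (cong suc (length-filter-∁ xs))

  length-filter-∷ : ∀ x xs → length (filter P? xs) ≤ length (filter P? (x ∷ xs))
  length-filter-∷ x xs with P? x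
  ... | yes _ = ℕP.n≤1+n _
  ... | no _  = ℕP.≤-refl

  length-filter-filter : ∀ {Q : Pred A 0ℓ} (Q? : Decidable Q) xs →
    length (filter P? (filter Q? xs)) ≤ length (filter P? xs)
  length-filter-filter Q? []       = z≤n
  length-filter-filter Q? (x ∷ xs) with Q? x
  ... | no _  = ℕP.≤-trans (length-filter-filter Q? xs) (length-filter-∷ x xs)
  ... | yes _ with P? x
  ...   | yes _ = s≤s (length-filter-filter Q? xs)
  ...   | no _  = length-filter-filter Q? xs

missing : ∀ {D} (ds : List (Fin D)) → length ds < D → ∃[ d ] ¬ d ∈ ds
missing {D} ds short = FP.¬∀⟶∃¬ D (_∈ ds) (λ d → DecMembership._∈?_ FP._≟_ d ds) not-all
  where
  not-all : ¬ (∀ d → d ∈ ds)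
  not-all all with i , j , i<j , eq ← FP.pigeonhole short (index ∘ all) =
    FP.<⇒≢ i<j (trans (lookup-index (all i)) (trans (cong (lookup ds) eq) (sym (lookup-index (all j)))))

xor-cancelʳ : ∀ a b c → a xor c ≡ b xor c → a ≡ b
xor-cancelʳ true  true  c     _ = refl
xor-cancelʳ false false c     _ = refl
xor-cancelʳ true  false true  ()
xor-cancelʳ true  false false ()
xor-cancelʳ false true  true  ()
xor-cancelʳ false true  false ()

bit : Bool → Fin 2
bit true  = suc zero
bit false = zero

bit-injective : ∀ {a b} → bit a ≡ bit b → a ≡ b
bit-injective {true}  {true}  _ = refl
bit-injective {false} {false} _ = refl

funToFin-injective : ∀ {m n} {f g : Fin m → Fin n} → funToFin f ≡ funToFin g → f ≗ g
funToFin-injective {f = f} {g} eq i = begin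
  f i                       ≡⟨ FP.finToFun-funToFin f i ⟨
  finToFun (funToFin f) i   ≡⟨ cong (λ x → finToFun x i) eq ⟩
  finToFun (funToFin g) i   ≡⟨ FP.finToFun-funToFin g i ⟩
  g i                       ∎
  where open ≡-Reasoning

join-injective : ∀ m n {x y : Fin m ⊎ Fin n} → join m n x ≡ join m n y → x ≡ y
join-injective m n {x} {y} eq =
  trans (sym (FP.splitAt-join m n x)) (trans (cong (splitAt m) eq) (FP.splitAt-join m n y))

module Palette
  {k T : ℕ} {A : Set} (_≟_ : DecidableEquality A)
  (pos : Fin k → Fin T) (centre : Fin k → A)
  {Hits : Fin k → Fin T → Set} (Hits? : ∀ c j → Dec (Hits c j))
  (hits-pos : ∀ c → Hits c (pos c)) (hits-≥ : ∀ {c j} → Hits c j → pos c F.≤ j)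
  where

  Word : Set
  Word = Fin T → A

  -- `moved` applies at `pos c` itself, so exactly one of the two words has the letter `centre c`
  -- there.
  record Edge (c : Fin k) (u v : Word) : Set where
    field
      end   : u (pos c) ≡ centre c ⊎ v (pos c) ≡ centre c
      moved : ∀ {j} → Hits c j → u j ≢ v j
      fixed : ∀ {j} → ¬ Hits c j → u j ≡ v j

  open Edge

  Proper : ∀ {N} → (Word → Fin N) → List (Fin k) → Set
  Proper f C = ∀ {c u v} → c ∈ C → Edge c u v → f u ≢ f v

  hitting : Fin T → List (Fin k) → List (Fin k)
  hitting j = filter (λ c → Hits? c j)

  avoiding : Fin T → List (Fin k) → List (Fin k)
  avoiding j = filter (λ c → ¬? (Hits? c j))

  Descending : List (Fin k) → Set
  Descending = AllPairs (λ c c′ → pos c′ F.≤ pos c)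

  module _ {D : ℕ} where

    Compatible : Fin k × Fin D → Fin k × Fin D → Set
    Compatible (c , d) (c′ , d′) = d ≡ d′ → ¬ Hits c (pos c′) × ¬ Hits c′ (pos c)

    flips : Fin k × Fin D → Fin D → Word → Bool
    flips (c , d′) d u = does (d′ FP.≟ d) ∧ does (u (pos c) ≟ centre c)

    parity : List (Fin k × Fin D) → Fin D → Word → Bool
    parity []      d u = false
    parity (p ∷ P) d u = flips p d u xor parity P d u

    flips-fixed : ∀ {c p d u v} → Edge c u v → (proj₂ p ≡ d → ¬ Hits c (pos (proj₁ p))) →
      flips p d u ≡ flips p d v
    flips-fixed {p = c′ , d′} {d} e ¬hits with d′ FP.≟ d
    ... | no _  = refl
    ... | yes p = cong (λ x → does (x ≟ centre c′)) (fixed e (¬hits p))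

    flips-moved : ∀ {c d u v} → Edge c u v → flips (c , d) d u ≢ flips (c , d) d v
    flips-moved {c} {d} {u} {v} e eq rewrite dec-true (d FP.≟ d) refl
      with u (pos c) ≟ centre c | v (pos c) ≟ centre c | end e
    ... | yes p | yes q | _      = moved e (hits-pos c) (trans p (sym q))
    ... | no ¬p | no _  | inj₁ p = ¬p p
    ... | no _  | no ¬q | inj₂ q = ¬q q
    ... | yes _ | no _  | _      with () ← eq
    ... | no _  | yes _ | _      with () ← eq

    parity-fixed : ∀ {c d u v} P → Edge c u v → (∀ {c′} → (c′ , d) ∈ P → ¬ Hits c (pos c′)) →
      parity P d u ≡ parity P d v
    parity-fixed []      e ¬hits = refl
    parity-fixed (p ∷ P) e ¬hits = cong₂ _xor_
      (flips-fixed {p = p} e λ { refl → ¬hits (here refl) }) (parity-fixed P e (¬hits ∘ there))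

    -- Inside class `d` only the entry of `c` changes its contribution: by compatibility `c` hits
    -- the position of no other entry of the class.
    parity-moved : ∀ {c d u v P} → AllPairs Compatible P → (c , d) ∈ P → Edge c u v →
      parity P d u ≢ parity P d v
    parity-moved {c} {d} {u} {v} {p ∷ P} (ok ∷ _) (here refl) e eq =
      flips-moved {d = d} e (xor-cancelʳ _ _ (parity P d u) (trans eq (cong (flips p d v xor_)
        (sym (parity-fixed P e λ p∈P → proj₁ (All.lookup ok p∈P refl))))))
    parity-moved {c} {d} {u} {v} {p ∷ P} (ok ∷ oks) (there cd∈P) e eq =
      parity-moved oks cd∈P e (xor-cancelˡ (flips p d u) (trans eq (cong (_xor parity P d v)
        (sym (flips-fixed {p = p} e λ d′≡d → proj₂ (All.lookup ok cd∈P d′≡d))))))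
      where
      xor-cancelˡ : ∀ a {b c} → a xor b ≡ a xor c → b ≡ c
      xor-cancelˡ true  {true}  {true}  _ = refl
      xor-cancelˡ true  {false} {false} _ = refl
      xor-cancelˡ false eq = eq

    Light : List (Fin k) → Set
    Light C = ∀ {c} → c ∈ C → length (hitting (pos c) C) ≤ D

    -- Colours are treated by increasing position, so that a new colour can only conflict with
    -- the at most D - 1 earlier colours which hit its position.
    classes : ∀ C → Descending C → Light C →
      ∃[ P ] (map proj₁ P ≡ C × AllPairs Compatible P)
    classes []      _            _     = [] , refl , []
    classes (c ∷ C) (c≥C ∷ desc) light
      with P , refl , ok ← classes C desc (λ c∈C →
             ℕP.≤-trans (length-filter-∷ (λ c′ → Hits? c′ _) c C) (light (there c∈C)))
      = (c , d) ∷ P , refl , All.tabulate compatible ∷ ok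
      where
      blocking : List (Fin k × Fin D)
      blocking = filter (λ p → Hits? (proj₁ p) (pos c)) P

      length-blocking : ∀ P → length (map proj₂ (filter (λ p → Hits? (proj₁ p) (pos c)) P))
                            ≡ length (hitting (pos c) (map proj₁ P))
      length-blocking []       = refl
      length-blocking (p ∷ P′) with Hits? (proj₁ p) (pos c)
      ... | yes _ = cong suc (length-blocking P′)
      ... | no _  = length-blocking P′

      -- `c` hits its own position and is counted by `light`, which leaves at most `D - 1` earlier
      -- colours.
      short : length (map proj₂ blocking) < D
      short = subst (_≤ D)
        (trans (cong length (LP.filter-accept (λ c′ → Hits? c′ (pos c)) (hits-pos c)))
               (cong suc (sym (length-blocking P))))
        (light (here refl))

      d : Fin D
      d = proj₁ (missing (map proj₂ blocking) short)

      d∉ : ∀ {c′} → (c′ , d) ∈ P → ¬ Hits c′ (pos c)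
      d∉ p∈P hits = proj₂ (missing (map proj₂ blocking) short)
        (∈-map⁺ proj₂ (∈-filter⁺ _ p∈P hits))

      compatible : ∀ {p} → p ∈ P → Compatible (c , d) p
      compatible {c′ , _} p∈P refl = ¬hits , d∉ p∈P
        where
        -- If `c` hits `pos c′`, then `pos c ≤ pos c′`; by the order of the list the two positions
        -- coincide, so `c′` hits `pos c`, against the choice of `d`.
        ¬hits : ¬ Hits c (pos c′)
        ¬hits hits = d∉ p∈P (subst (Hits c′) (FP.≤-antisym (All.lookup c≥C (∈-map⁺ proj₁ p∈P)) (hits-≥ hits))
                              (hits-pos c′))

    light-colouring : ∀ C → Descending C → Light C → Σ[ f ∈ (Word → Fin (2 ^ D)) ] Proper f C
    light-colouring C desc light with P , refl , ok ← classes C desc light = f , proper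
      where
      f : Word → Fin (2 ^ D)
      f u = funToFin λ d → bit (parity P d u)

      proper : Proper f (map proj₁ P)
      proper c∈C e eq with (c , d) , p∈P , refl ← ∈-map⁻ proj₁ c∈C =
        parity-moved ok p∈P e (bit-injective (funToFin-injective eq d))

  module _ (D : ℕ) where

    -- `2 ^ D` values for the words without a name and, for each of `k` names, a fresh copy of the
    -- previous palette; `q` bounds the number of nested names.
    size : ℕ → ℕ
    size zero    = 2 ^ D
    size (suc q) = 2 ^ D + k * size q

    lighter : List (Fin k) → List (Fin k)
    lighter C = filter (λ c → length (hitting (pos c) C) ≤? D) C

    lighter-light : ∀ C → Light {D} (lighter C)
    lighter-light C c∈ = ℕP.≤-trans (length-filter-filter _ _ C) (proj₂ (∈-filter⁻ _ {xs = C} c∈))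

    HeavyCentre : List (Fin k) → Word → Fin k → Set
    HeavyCentre C u c = ¬ (length (hitting (pos c) C) ≤ D) × u (pos c) ≡ centre c

    heavyCentre? : ∀ C u → Dec (Any (HeavyCentre C u) C)
    heavyCentre? C u = any? (λ c → ¬? (length (hitting (pos c) C) ≤? D) ×-dec (u (pos c) ≟ centre c)) C

    -- Two words named after the same colour c agree at pos c, so no colour that hits pos c joins
    -- them; the words without a name meet no colour at a heavy position.
    colouring : ∀ q C → Descending C →
      Σ[ f ∈ (Word → Fin (size q)) ] (length C < D * suc q → Proper f C)
    -- Here fewer than `D` colours are promised, so every position is light. The branch with more
    -- than `D` returns a constant, since properness is claimed only for short lists.
    colouring zero C desc with length C ≤? D
    ... | no ¬p = (λ _ → funToFin {D} {2} λ _ → zero) ,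
                  λ short → ⊥-elim (¬p (subst (length C ≤_) (ℕP.*-identityʳ D) (ℕP.<⇒≤ short)))
    ... | yes p with f , proper ← light-colouring {D} C desc (λ _ → ℕP.≤-trans (LP.length-filter _ C) p)
      = f , λ _ → proper
    colouring (suc q) C desc = f , proper
      where
      light = light-colouring {D} (lighter C) (APP.filter⁺ _ desc) (lighter-light C)

      -- Needed as a function for every colour, also where the list does not shrink; hence the
      -- length bound is a premise of properness and not of the colouring.
      rest : ∀ c → Σ[ f ∈ (Word → Fin (size q)) ]
            (length (avoiding (pos c) C) < D * suc q → Proper f (avoiding (pos c) C))
      rest c = colouring q (avoiding (pos c) C) (APP.filter⁺ _ desc)

      name : ∀ u → Dec (Any (HeavyCentre C u) C) → Fin (2 ^ D) ⊎ Fin (k * size q)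
      name u (yes h) = inj₂ (combine (proj₁ (find h)) (proj₁ (rest (proj₁ (find h))) u))
      name u (no _)  = inj₁ (proj₁ light u)

      f : Word → Fin (2 ^ D + k * size q)
      f u = join (2 ^ D) (k * size q) (name u (heavyCentre? C u))

      shrinks : length C < D * suc (suc q) → ∀ j → ¬ (length (hitting j C) ≤ D) →
        length (avoiding j C) < D * suc q
      shrinks short j heavy = ℕP.+-cancelˡ-< D _ _ (begin-strict
        D + length (avoiding j C)                     ≤⟨ ℕP.+-monoˡ-≤ _ (ℕP.<⇒≤ (ℕP.≰⇒> heavy)) ⟩
        length (hitting j C) + length (avoiding j C)  ≡⟨ length-filter-∁ (λ c → Hits? c j) C ⟩
        length C                                      <⟨ short ⟩
        D * suc (suc q)                               ≡⟨ ℕP.*-suc D (suc q) ⟩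
        D + D * suc q                                 ∎)
        where open ℕP.≤-Reasoning

      distinct : length C < D * suc (suc q) → ∀ {c u v} → c ∈ C → Edge c u v → ∀ hu hv →
        name u hu ≢ name v hv
      distinct short {c} {u} {v} c∈C e (yes hu) (yes hv) eq
        with c₁ , _ , heavy , u≡ ← find hu | c₂ , _ , _ , v≡ ← find hv
        with refl , eq′ ← FP.combine-injective c₁ _ c₂ _ (inj₂-injective eq)
        = proj₂ (rest c₁) (shrinks short (pos c₁) heavy)
            (∈-filter⁺ _ c∈C λ hits → moved e hits (trans u≡ (sym v≡))) e eq′
      distinct short {c} {u} {v} c∈C e (no ¬hu) (no ¬hv) eq
        with length (hitting (pos c) C) ≤? D | end e
      ... | yes few  | _ = proj₂ light (∈-filter⁺ _ c∈C few) e (inj₁-injective eq)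
      ... | no heavy | inj₁ u≡ = ¬hu (lose c∈C (heavy , u≡))
      ... | no heavy | inj₂ v≡ = ¬hv (lose c∈C (heavy , v≡))

      proper : length C < D * suc (suc q) → Proper f C
      proper short {u = u} {v} c∈C e eq =
        distinct short c∈C e (heavyCentre? C u) (heavyCentre? C v) (join-injective (2 ^ D) (k * size q) eq)

    -- The summand `2 ^ D` is at most `2 ^ (l * q + D)`, so it is absorbed by turning the factor `k`
    -- into `suc k`: each name costs `l` bits.
    size-bound : ∀ {l} → suc k ≤ 2 ^ l → ∀ q → size q ≤ 2 ^ (l * q + D)
    size-bound {l} k<2^l zero    rewrite ℕP.*-zeroʳ l = ℕP.≤-refl
    size-bound {l} k<2^l (suc q) = begin
      2 ^ D + k * size q            ≤⟨ ℕP.+-mono-≤ (ℕP.^-monoʳ-≤ 2 (ℕP.m≤n+m D (l * q)))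
                                                        (ℕP.*-monoʳ-≤ k (size-bound {l} k<2^l q)) ⟩
      2 ^ (l * q + D) + k * 2 ^ (l * q + D)  ≡⟨⟩
      suc k * 2 ^ (l * q + D)                ≤⟨ ℕP.*-monoˡ-≤ _ k<2^l ⟩
      2 ^ l * 2 ^ (l * q + D)                ≡⟨ ℕP.^-distribˡ-+-* 2 l (l * q + D) ⟨
      2 ^ (l + (l * q + D))                  ≡⟨ cong (2 ^_) (sym (trans (cong (_+ D) (ℕP.*-suc l q)) (ℕP.+-assoc l (l * q) D))) ⟩
      2 ^ (l * suc q + D)                    ∎
      where open ℕP.≤-Reasoning

  private
    module Sort = Data.List.Sort (Flip.decTotalOrder (On.decTotalOrder (FP.≤-decTotalOrder T) pos))

  sort-descending : ∀ C → Descending (Sort.sort C)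
  sort-descending C = Linked⇒AllPairs (λ p q → FP.≤-trans q p) (Sort.sort-↗ C)

  unsort : ∀ {N} {f : Word → Fin N} C → Proper f (Sort.sort C) → Proper f C
  unsort C proper c∈C = proper (∈-resp-↭ (↭-sym (Sort.sort-↭ C)) c∈C)

  -- No position is hit by more than `length C` colours, so `D = length C` makes all of them light.
  -- This serves the range where the optimal `D` would be below 1.
  colouring-few : ∀ C → Σ[ f ∈ (Word → Fin (2 ^ length C)) ] Proper f C
  colouring-few C = f , unsort C proper
    where
    S = light-colouring {length C} (Sort.sort C) (sort-descending C) λ _ →
          ℕP.≤-trans (LP.length-filter _ (Sort.sort C)) (ℕP.≤-reflexive (↭-length (Sort.sort-↭ C)))
    f = proj₁ S
    proper = proj₂ S

  colouring-many : ∀ D .{{_ : NonZero D}} C → Σ[ f ∈ (Word → Fin (size D (length C / D))) ] Proper f C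
  colouring-many D C = proj₁ S , unsort C (proj₂ S short)
    where
    S = colouring D (length C / D) (Sort.sort C) (sort-descending C)
    short : length (Sort.sort C) < D * suc (length C / D)
    short = begin-strict
      length (Sort.sort C)                ≡⟨ ↭-length (Sort.sort-↭ C) ⟩
      length C                            ≡⟨ m≡m%n+[m/n]*n (length C) D ⟩
      length C % D + length C / D * D     <⟨ ℕP.+-monoˡ-< _ (m%n<n (length C) D) ⟩
      D + length C / D * D                ≡⟨ ℕP.*-comm (suc (length C / D)) D ⟩
      D * suc (length C / D)              ∎
      where open ℕP.≤-Reasoning

-- Chromatic numbers

least : ∀ {P : ℕ → Set} → Decidable P → ∀ {n} → P n → ∃[ k ] (P k × (∀ j → P j → k ≤ j))
least P? {n} Pn with P? zero
... | yes P0 = zero , P0 , λ _ _ → z≤n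
least P? {zero}  Pn | no ¬P0 = contradiction Pn ¬P0
least P? {suc n} Pn | no ¬P0 with k , Pk , min ← least (P? ∘ suc) Pn =
  suc k , Pk , λ { zero P0 → contradiction P0 ¬P0 ; (suc j) Pj → s≤s (min j Pj) }

module _ {n} (G : Graph n) (adj? : ∀ u v → Dec (Adj G u v)) where

  colourable? : ∀ k → Dec (Colourable G k)
  colourable? k = map′
    (λ (i , proper) → finToFun i , λ {u} {v} → proper u v)
    (λ (c , proper) → funToFin c , λ u v e eq → proper e
       (trans (sym (FP.finToFun-funToFin c u)) (trans eq (FP.finToFun-funToFin c v))))
    (FP.any? λ i → FP.all? λ u → FP.all? λ v → adj? u v →-dec ¬? (finToFun i u FP.≟ finToFun i v))

  chromaticNumber : ∀ {N} → Colourable G N → ∃[ k ] (IsChromaticNumber G k × k ≤ N)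
  chromaticNumber {N} c with k , ck , min ← least colourable? c = k , (ck , min) , min N c

Colourable-mono : ∀ {n} {G : Graph n} {k l} → k ≤ l → Colourable G k → Colourable G l
Colourable-mono k≤l (c , proper) =
  (λ u → inject≤ (c u) k≤l) , λ e eq → proper e (FP.inject≤-injective _ _ _ _ eq)

-- Finite products and sums

tuple : ∀ {b} {N : Fin b → ℕ} → (∀ s → Fin (N s)) → Fin (∏ N)
tuple {zero}  f = zero
tuple {suc b} f = combine (f zero) (tuple (f ∘ suc))

tuple-injective : ∀ {b} {N : Fin b → ℕ} {f g : ∀ s → Fin (N s)} → tuple f ≡ tuple g → ∀ s → f s ≡ g s
tuple-injective eq zero    = proj₁ (FP.combine-injective _ _ _ _ eq)
tuple-injective {f = f} {g} eq (suc s) =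
  tuple-injective (proj₂ (FP.combine-injective (f zero) _ (g zero) _ eq)) s

∏≤2^sum : ∀ {b} (N z : Fin b → ℕ) → (∀ s → N s ≤ 2 ^ z s) → ∏ N ≤ 2 ^ sum z
∏≤2^sum {zero}  N z N≤ = ℕP.≤-refl
∏≤2^sum {suc b} N z N≤ = ℕP.≤-trans (ℕP.*-mono-≤ (N≤ zero) (∏≤2^sum (N ∘ suc) (z ∘ suc) (N≤ ∘ suc)))
  (ℕP.≤-reflexive (sym (ℕP.^-distribˡ-+-* 2 (z zero) _)))

sum-mono : ∀ {b} {f g : Fin b → ℕ} → (∀ s → f s ≤ g s) → sum f ≤ sum g
sum-mono {zero}  f≤g = z≤n
sum-mono {suc b} f≤g = ℕP.+-mono-≤ (f≤g zero) (sum-mono (f≤g ∘ suc))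

sum-* : ∀ {b} a (f : Fin b → ℕ) → sum (λ s → a * f s) ≡ a * sum f
sum-* {zero}  a f = sym (ℕP.*-zeroʳ a)
sum-* {suc b} a f = trans (cong (a * f zero +_) (sum-* a (f ∘ suc))) (sym (ℕP.*-distribˡ-+ a _ _))

sum-const : ∀ b a → sum {b} (λ _ → a) ≡ a * b
sum-const zero    a = sym (ℕP.*-zeroʳ a)
sum-const (suc b) a = trans (cong (a +_) (sum-const b a)) (sym (ℕP.*-suc a b))

sum-indicator : ∀ {b} (x : Fin b) → sum (λ s → if does (x FP.≟ s) then 1 else 0) ≡ 1
sum-indicator {suc b} zero    = cong suc (sum-replicate-zero b)
sum-indicator {suc b} (suc x) = sum-indicator x

fibre : ∀ {A : Set} {b} → (A → Fin b) → List A → Fin b → List A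
fibre f xs s = filter (λ x → f x FP.≟ s) xs

sum-fibres : ∀ {A : Set} {b} (f : A → Fin b) xs → sum (λ s → length (fibre f xs s)) ≡ length xs
sum-fibres {b = b} f []       = sum-replicate-zero b
sum-fibres {b = b} f (x ∷ xs) = begin
  sum (λ s → length (fibre f (x ∷ xs) s))                                ≡⟨ sum-cong-≗ {b} step ⟩
  sum (λ s → (if does (f x FP.≟ s) then 1 else 0) + length (fibre f xs s)) ≡⟨ ∑-distrib-+ {b} _ _ ⟩
  sum {b} (λ s → if does (f x FP.≟ s) then 1 else 0) + sum (λ s → length (fibre f xs s))
                                                                         ≡⟨ cong₂ _+_ (sum-indicator (f x)) (sum-fibres f xs) ⟩
  suc (length xs)                                                        ∎
  where
  open ≡-Reasoning
  step : ∀ s → length (fibre f (x ∷ xs) s) ≡ (if does (f x FP.≟ s) then 1 else 0) + length (fibre f xs s)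
  step s with does (f x FP.≟ s)
  ... | true  = refl
  ... | false = refl

elements : ∀ {n} → Subset n → List (Fin n)
elements [] = []
elements (inside  ∷ p) = zero ∷ map suc (elements p)
elements (outside ∷ p) = map suc (elements p)

length-elements : ∀ {n} (p : Subset n) → length (elements p) ≡ ∣ p ∣
length-elements [] = refl
length-elements (inside  ∷ p) = cong suc (trans (LP.length-map suc (elements p)) (length-elements p))
length-elements (outside ∷ p) = trans (LP.length-map suc (elements p)) (length-elements p)

∈-elements : ∀ {n} {p : Subset n} {i} → i Sub.∈ p → i ∈ elements p
∈-elements {p = inside  ∷ p} here        = here refl
∈-elements {p = inside  ∷ p} (there i∈p) = there (∈-map⁺ suc (∈-elements i∈p))
∈-elements {p = outside ∷ p} (there i∈p) = ∈-map⁺ suc (∈-elements i∈p)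

-- The edge colouring

-- The last index is the default if `f` is nowhere true, which makes `code` total.
first : ∀ {b} → (Fin (suc b) → Bool) → Fin (suc b)
first {zero}  f = zero
first {suc b} f = if f zero then zero else suc (first (f ∘ suc))

first-cong : ∀ {b} {f g : Fin (suc b) → Bool} → f ≗ g → first f ≡ first g
first-cong {zero}  f≗g = refl
first-cong {suc b} f≗g rewrite f≗g zero | first-cong (f≗g ∘ suc) = refl

first-true : ∀ {b} (f : Fin (suc b) → Bool) {i} → f i ≡ true → f (first f) ≡ true
first-true {zero}  f {zero} fi = fi
first-true {suc b} f {i} fi with f zero in f0
... | true = f0
first-true {suc b} f {zero}  fi | false with () ← trans (sym f0) fi
first-true {suc b} f {suc i} fi | false = first-true (f ∘ suc) fi

first-min : ∀ {b} (f : Fin (suc b) → Bool) {j} → f j ≡ true → first f F.≤ j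
first-min {zero}  f {zero} fj = z≤n
first-min {suc b} f {j} fj with f zero in f0
... | true = z≤n
first-min {suc b} f {zero}  fj | false with () ← trans (sym f0) fj
first-min {suc b} f {suc j} fj | false = s≤s (first-min (f ∘ suc) fj)

funToFin-cong : ∀ {m n} {f g : Fin m → Fin n} → f ≗ g → funToFin f ≡ funToFin g
funToFin-cong {zero}  f≗g = refl
funToFin-cong {suc m} f≗g = cong₂ combine (f≗g zero) (funToFin-cong (f≗g ∘ suc))

finToFun-injective : ∀ m {n} (x y : Fin (n ^ m)) → finToFun {n} {m} x ≗ finToFun y → x ≡ y
finToFun-injective m {n} x y eq =
  trans (sym (FP.funToFin-finToFin {m} {n} x)) (trans (funToFin-cong eq) (FP.funToFin-finToFin {m} {n} y))

smaller : ∀ {m} → Fin m → Fin m → Fin m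
smaller x y = if does (x FP.≤? y) then x else y

pick : ∀ {m} (x y : Fin m) {t} → does (x FP.≤? y) ≡ t → smaller x y ≡ (if t then x else y)
pick x y eq = cong (if_then x else y) eq

smaller-sym : ∀ {m} (x y : Fin m) → smaller x y ≡ smaller y x
smaller-sym x y with FP.<-cmp x y
... | tri< lt _ ¬gt = trans (pick x y (dec-true (x FP.≤? y) (ℕP.<⇒≤ lt)))
                        (sym (pick y x (dec-false (y FP.≤? x) (ℕP.<⇒≱ lt))))
... | tri≈ _ refl _ = refl
... | tri> ¬lt _ gt = trans (pick x y (dec-false (x FP.≤? y) (ℕP.<⇒≱ gt)))
                        (sym (pick y x (dec-true (y FP.≤? x) (ℕP.<⇒≤ gt))))

smaller-sel : ∀ {m} (x y : Fin m) → x ≡ smaller x y ⊎ y ≡ smaller x y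
smaller-sel x y with does (x FP.≤? y)
... | true  = inj₁ refl
... | false = inj₂ refl

uncombine : ∀ {b} T m P → Fin (b * (T * (m * P))) → Fin b × Fin T × Fin m × Fin P
uncombine T m P = map₂ (map₂ (remQuot P) ∘ remQuot (m * P)) ∘ remQuot (T * (m * P))

uncombine-combine : ∀ {b T m P} (s : Fin b) (i : Fin T) (x : Fin m) (a : Fin P) →
  uncombine T m P (combine s (combine i (combine x a))) ≡ (s , i , x , a)
uncombine-combine {m = m} {P} s i x a =
  trans (cong (map₂ (map₂ (remQuot P) ∘ remQuot (m * P))) (FP.remQuot-combine s _)) (cong (s ,_)
  (trans (cong (map₂ (remQuot P)) (FP.remQuot-combine i _)) (cong (i ,_) (FP.remQuot-combine x a))))

module Words (b T m : ℕ) where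

  differ : (Fin T → Fin m) → (Fin T → Fin m) → Fin T → Bool
  differ u v i = does (¬? (u i FP.≟ v i))

  differ-sym : ∀ u v → differ u v ≗ differ v u
  differ-sym u v i = does-⇔ (mk⇔ (λ ne → ne ∘ sym) (λ ne → ne ∘ sym)) (¬? (u i FP.≟ v i)) (¬? (v i FP.≟ u i))

  agree? : ∀ (u v : Fin T → Fin m) → Dec (u ≗ v)
  agree? u v = FP.all? λ i → u i FP.≟ v i

  block-differ : (u v : Fin b → Fin T → Fin m) → Fin b → Bool
  block-differ u v s = does (¬? (agree? (u s) (v s)))

  block-differ-sym : ∀ u v → block-differ u v ≗ block-differ v u
  block-differ-sym u v s = does-⇔ (mk⇔ (λ ne eq → ne (sym ∘ eq)) (λ ne eq → ne (sym ∘ eq)))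
    (¬? (agree? (u s) (v s))) (¬? (agree? (v s) (u s)))

-- `b` and `T` are given by predecessors, as `first` needs nonempty ranges. Vertices embed in the
-- tuples of words and codes in the `M` colours; the colours from `Q` on get no edges.
module EdgeColouring (n b′ T′ m M : ℕ) (n≤ : n ≤ (m ^ suc T′) ^ suc b′)
  (≤M : suc b′ * (suc T′ * (m * 2 ^ suc T′)) ≤ M) .{{_ : NonZero m}} where

  b T : ℕ
  b = suc b′
  T = suc T′

  open Words b T m

  Q : ℕ
  Q = b * (T * (m * 2 ^ T))

  instance
    Q≢0 : NonZero Q
    Q≢0 = ℕP.m*n≢0 b (T * (m * 2 ^ T)) {{_}}
      {{ℕP.m*n≢0 T (m * 2 ^ T) {{_}} {{ℕP.m*n≢0 m (2 ^ T) {{it}} {{ℕP.m^n≢0 2 T}}}}}}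

  word : Fin n → Fin b → Fin T → Fin m
  word v s = finToFun {m} {T} (finToFun {m ^ T} {b} (inject≤ v n≤) s)

  word-injective : ∀ {u v} → (∀ s → word u s ≗ word v s) → u ≡ v
  word-injective {u} {v} eq = FP.inject≤-injective n≤ n≤ u v
    (finToFun-injective b (inject≤ u n≤) (inject≤ v n≤) λ s →
      finToFun-injective T (finToFun {m ^ T} {b} (inject≤ u n≤) s) (finToFun {m ^ T} {b} (inject≤ v n≤) s) (eq s))

  block : Fin n → Fin n → Fin b
  block u v = first (block-differ (word u) (word v))

  module _ (u v : Fin n) where
    place : Fin b → Fin T
    place s = first (differ (word u s) (word v s))

    centre : Fin b → Fin T → Fin m
    centre s i = smaller (word u s i) (word v s i)

    pattern-code : Fin b → Fin (2 ^ T)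
    pattern-code s = funToFin (bit ∘ differ (word u s) (word v s))

    codeAt : Fin b → Fin Q
    codeAt s = combine s (combine (place s) (combine (centre s (place s)) (pattern-code s)))

    code : Fin Q
    code = codeAt (block u v)

  code-sym : ∀ u v → code u v ≡ code v u
  code-sym u v = trans (cong (codeAt u v) (first-cong (block-differ-sym (word u) (word v)))) (at (block v u))
    where
    at : ∀ s → codeAt u v s ≡ codeAt v u s
    at s = cong (combine s) (cong₂ combine place-sym (cong₂ combine
      (trans (cong (centre u v s) place-sym) (smaller-sym (word u s (place v u s)) (word v s (place v u s))))
      (funToFin-cong (cong bit ∘ differ-sym (word u s) (word v s)))))
      where
      place-sym : place u v s ≡ place v u s
      place-sym = first-cong (differ-sym (word u s) (word v s))

  -- `code u u` is built on default values, so loops are excluded explicitly.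
  E : Fin M → Graph n
  E c = record
    { Adj    = λ u v → u ≢ v × inject≤ (code u v) ≤M ≡ c
    ; sym    = λ {u} {v} (u≢v , eq) → u≢v ∘ sym , trans (cong (λ p → inject≤ p ≤M) (code-sym v u)) eq
    ; irrefl = λ u≡v (u≢v , _) → u≢v u≡v
    }

  E-partition : IsEdgePartition (K n) E
  E-partition = record
    { sub      = λ _ → proj₁
    ; cover    = λ {u} {v} u≢v → inject≤ (code u v) ≤M , u≢v , refl
    ; disjoint = λ (_ , p) (_ , q) → trans (sym p) q
    }

  -- Vertex colourings of a union of colour classes

  module Union (I : Subset M) where

    -- The palette is indexed by the members of `I` and not by all of `Fin M`, so the factor in
    -- `size` is `∣ I ∣`.
    k : ℕ
    k = length (elements I)

    -- Reduction modulo `Q` makes this total on `Fin M`; the members of `I` from `Q` on get an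
    -- arbitrary entry and have no edges.
    decode : Fin M → Fin b × Fin T × Fin m × (Fin T → Fin 2)
    decode c = map₂ (map₂ (map₂ finToFun)) (uncombine {b} T m (2 ^ T) (toℕ c mod Q))

    mod-inject : ∀ {p : Fin Q} → toℕ (inject≤ p ≤M) mod Q ≡ p
    mod-inject {p} = FP.toℕ-injective (trans (FP.toℕ-fromℕ< _)
      (trans (cong (_% Q) (FP.toℕ-inject≤ p ≤M)) (m<n⇒m%n≡m (FP.toℕ<n p))))

    decode-combine : ∀ s i x a {c} → c ≡ inject≤ (combine s (combine i (combine x a))) ≤M →
      decode c ≡ (s , i , x , finToFun a)
    decode-combine s i x a refl = cong (map₂ (map₂ (map₂ finToFun)))
      (trans (cong (uncombine {b} T m (2 ^ T)) mod-inject) (uncombine-combine s i x a))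

    entry : Fin k → Fin b × Fin T × Fin m × (Fin T → Fin 2)
    entry c = decode (lookup (elements I) c)

    blockOf : Fin k → Fin b
    blockOf = proj₁ ∘ entry

    pos : Fin k → Fin T
    pos = proj₁ ∘ proj₂ ∘ entry

    -- For the code of an edge this is the set of differing positions. An arbitrary member of `I`
    -- may carry any vector `a`, so hitting `i` and no earlier position is forced here, and the
    -- premises of `Palette` hold for all colours.
    Marks : Fin b × Fin T × Fin m × (Fin T → Fin 2) → Fin T → Set
    Marks (_ , i , _ , a) j = i ≡ j ⊎ (i F.< j × a j ≡ suc zero)

    Hits : Fin k → Fin T → Set
    Hits c = Marks (entry c)

    hits-≥ : ∀ {c j} → Hits c j → pos c F.≤ j
    hits-≥ (inj₁ refl)    = ℕP.≤-refl
    hits-≥ (inj₂ (p , _)) = ℕP.<⇒≤ p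

    open Palette {k} {T} FP._≟_ pos (proj₁ ∘ proj₂ ∘ proj₂ ∘ entry) {Hits}
      (λ c j → (pos c FP.≟ j) ⊎-dec ((pos c FP.<? j) ×-dec (_ FP.≟ _)))
      (λ _ → inj₁ refl) (λ {c} {j} → hits-≥ {c} {j}) public

    edge : ∀ {u v} → Adj (𝒢 E I) u v →
      ∃[ c ] Edge c (word u (blockOf c)) (word v (blockOf c))
    edge {u} {v} (i , i∈I , u≢v , code≡i) = c , subst (λ s → Edge c (word u s) (word v s)) (sym (cong proj₁ entry≡)) e
      where
      i∈ = ∈-elements i∈I
      c  = index i∈
      s  = block u v
      wᵤ  = word u s
      wᵥ  = word v s

      entry≡ : entry c ≡ (s , place u v s , centre u v s (place u v s) , finToFun (pattern-code u v s))
      entry≡ = decode-combine _ _ _ _ (trans (sym (lookup-index i∈)) (sym code≡i))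

      wᵤ≢wᵥ : ¬ (wᵤ ≗ wᵥ)
      wᵤ≢wᵥ with agree? wᵤ wᵥ in eq
      ... | no ne = ne
      ... | yes _ = contradiction (trans (sym (cong (not ∘ does) eq))
                      (first-true (block-differ (word u) (word v)) {proj₁ some} (proj₂ some))) λ ()
        where
        some : ∃[ s ] block-differ (word u) (word v) s ≡ true
        some with t , ne ← FP.¬∀⟶∃¬ b (λ s → word u s ≗ word v s) (λ s → agree? _ _) (u≢v ∘ word-injective)
          = t , dec-true (¬? (agree? _ _)) ne

      differ⇒≢ : ∀ j → differ wᵤ wᵥ j ≡ true → wᵤ j ≢ wᵥ j
      differ⇒≢ j d with wᵤ j FP.≟ wᵥ j
      ... | no ne = ne

      ≢⇒differ : ∀ j → wᵤ j ≢ wᵥ j → differ wᵤ wᵥ j ≡ true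
      ≢⇒differ j = dec-true (¬? (wᵤ j FP.≟ wᵥ j))

      place-differs : differ wᵤ wᵥ (place u v s) ≡ true
      place-differs with t , ne ← FP.¬∀⟶∃¬ T _ (λ i → wᵤ i FP.≟ wᵥ i) wᵤ≢wᵥ =
        first-true (differ wᵤ wᵥ) {t} (≢⇒differ t ne)

      bits : ∀ j → finToFun (pattern-code u v s) j ≡ bit (differ wᵤ wᵥ j)
      bits = FP.finToFun-funToFin (bit ∘ differ wᵤ wᵥ)

      entry′ = (s , place u v s , centre u v s (place u v s) , finToFun (pattern-code u v s))

      moved′ : ∀ {j} → Marks entry′ j → wᵤ j ≢ wᵥ j
      moved′ (inj₁ refl)         = differ⇒≢ (place u v s) place-differs
      moved′ {j} (inj₂ (_ , eq)) = differ⇒≢ j (bit-injective (trans (sym (bits j)) eq))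

      fixed′ : ∀ {j} → ¬ Marks entry′ j → wᵤ j ≡ wᵥ j
      fixed′ {j} ¬hits with wᵤ j FP.≟ wᵥ j
      ... | yes eq = eq
      ... | no ne with FP.<-cmp (place u v s) j
      ...   | tri< lt _ _ = contradiction (inj₂ (lt , trans (bits j) (cong bit (≢⇒differ j ne)))) ¬hits
      ...   | tri≈ _ eq _ = contradiction (inj₁ eq) ¬hits
      ...   | tri> _ _ gt = contradiction (first-min (differ wᵤ wᵥ) (≢⇒differ j ne)) (ℕP.<⇒≱ gt)

      e : Edge c wᵤ wᵥ
      e = record
        { end   = subst (λ (_ , i , x , _) → wᵤ i ≡ x ⊎ wᵥ i ≡ x) (sym entry≡) (smaller-sel _ _)
        ; moved = λ {j} → subst (λ y → Marks y j → wᵤ j ≢ wᵥ j) (sym entry≡) moved′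
        ; fixed = λ {j} → subst (λ y → ¬ Marks y j → wᵤ j ≡ wᵥ j) (sym entry≡) fixed′
        }

    adj? : ∀ u v → Dec (Adj (𝒢 E I) u v)
    adj? u v = FP.any? λ i → (i SubP.∈? I) ×-dec (¬? (u FP.≟ v) ×-dec (_ FP.≟ i))

    coloursIn : Fin b → List (Fin k)
    coloursIn = fibre blockOf (allFin k)

    sum-coloursIn : sum (length ∘ coloursIn) ≡ k
    sum-coloursIn = trans (sum-fibres blockOf (allFin k)) (LP.length-tabulate {n = k} (λ i → i))

    product-colouring : ∀ {N : Fin b → ℕ} →
      (∀ s → Σ[ f ∈ (Word → Fin (N s)) ] Proper f (coloursIn s)) → Colourable (𝒢 E I) (∏ N)
    product-colouring {N} F = (λ v → tuple λ s → proj₁ (F s) (word v s)) , λ e eq →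
      let c , edge-c = edge e in
      proj₂ (F (blockOf c)) (∈-filter⁺ (λ c′ → blockOf c′ FP.≟ blockOf c) (∈-allFin c) refl) edge-c
        (tuple-injective {N = N} {λ s → proj₁ (F s) (word _ s)} {λ s → proj₁ (F s) (word _ s)} eq (blockOf c))

    colourable-few : Colourable (𝒢 E I) (2 ^ k)
    colourable-few = Colourable-mono {G = 𝒢 E I}
      (subst (λ z → ∏ (λ s → 2 ^ length (coloursIn s)) ≤ 2 ^ z) sum-coloursIn
        (∏≤2^sum {b} _ (length ∘ coloursIn) λ _ → ℕP.≤-refl))
      (product-colouring λ s → colouring-few (coloursIn s))

    -- The quotients of the blocks by `D`, rounded down, add up to at most `k / D`; apart from them
    -- each block costs `D` bits.
    colourable-many : ∀ D l .{{_ : NonZero D}} → suc k ≤ 2 ^ l →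
      ∃[ q ] (D * q ≤ k × Colourable (𝒢 E I) (2 ^ (l * q + D * b)))
    colourable-many D l k<2^l = sum q , D*q≤k ,
      Colourable-mono {G = 𝒢 E I}
        (subst (λ z → ∏ (λ s → size D (q s)) ≤ 2 ^ z) exponent
          (∏≤2^sum {b} _ (λ s → l * q s + D) λ s → size-bound D {l} k<2^l (q s)))
        (product-colouring λ s → colouring-many D (coloursIn s))
      where
      q : Fin b → ℕ
      q s = length (coloursIn s) / D

      D*q≤k : D * sum q ≤ k
      D*q≤k = begin
        D * sum q                     ≡⟨ sum-* D q ⟨
        sum (λ s → D * q s)           ≤⟨ sum-mono {b} (λ s → ℕP.≤-trans (ℕP.≤-reflexive (ℕP.*-comm D (q s)))
                                                        (m/n*n≤m (length (coloursIn s)) D)) ⟩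
        sum (length ∘ coloursIn)      ≡⟨ sum-coloursIn ⟩
        k                             ∎
        where open ℕP.≤-Reasoning

      exponent : sum (λ s → l * q s + D) ≡ l * sum q + D * b
      exponent = trans (∑-distrib-+ {b} (λ s → l * q s) (λ _ → D)) (cong₂ _+_ (sum-* l q) (sum-const b D))

-- Ordered-field facts

*-mono-≤ : ∀ {a b c d} → 0ℚ ≤ℚ a → 0ℚ ≤ℚ c → a ≤ℚ b → c ≤ℚ d → a *ℚ c ≤ℚ b *ℚ d
*-mono-≤ {a} {b} {c} {d} 0≤a 0≤c a≤b c≤d = ℚP.≤-trans
  (ℚP.*-monoʳ-≤-nonNeg c {{ℚ.nonNegative 0≤c}} a≤b)
  (ℚP.*-monoˡ-≤-nonNeg b {{ℚ.nonNegative (ℚP.≤-trans 0≤a a≤b)}} c≤d)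

*-mono-< : ∀ {a b c d} → 0ℚ ≤ℚ a → 0ℚ ≤ℚ c → a <ℚ b → c <ℚ d → a *ℚ c <ℚ b *ℚ d
*-mono-< {a} {b} {c} {d} 0≤a 0≤c a<b c<d = ℚP.≤-<-trans
  (ℚP.*-monoʳ-≤-nonNeg c {{ℚ.nonNegative 0≤c}} (ℚP.<⇒≤ a<b))
  (ℚP.*-monoʳ-<-pos b {{ℚ.positive (ℚP.≤-<-trans 0≤a a<b)}} c<d)

*-nonNeg : ∀ {a b} → 0ℚ ≤ℚ a → 0ℚ ≤ℚ b → 0ℚ ≤ℚ a *ℚ b
*-nonNeg {a} {b} 0≤a 0≤b = subst (_≤ℚ a *ℚ b) (ℚP.*-zeroˡ 0ℚ) (*-mono-≤ ℚP.≤-refl ℚP.≤-refl 0≤a 0≤b)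

*-pos : ∀ {a b} → 0ℚ <ℚ a → 0ℚ <ℚ b → 0ℚ <ℚ a *ℚ b
*-pos {a} {b} 0<a 0<b = subst (_<ℚ a *ℚ b) (ℚP.*-zeroˡ 0ℚ) (*-mono-< ℚP.≤-refl ℚP.≤-refl 0<a 0<b)

*-cancelʳ-< : ∀ {a b c} → 0ℚ ≤ℚ c → a *ℚ c <ℚ b *ℚ c → a <ℚ b
*-cancelʳ-< {c = c} 0≤c = ℚP.*-cancelʳ-<-nonNeg c {{ℚ.nonNegative 0≤c}}

*-cancelˡ-< : ∀ {a b c} → 0ℚ ≤ℚ c → c *ℚ a <ℚ c *ℚ b → a <ℚ b
*-cancelˡ-< {c = c} 0≤c = ℚP.*-cancelˡ-<-nonNeg c {{ℚ.nonNegative 0≤c}}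

0≤1 : 0ℚ ≤ℚ 1ℚ
0≤1 = *≤* (ℤ.+≤+ z≤n)

0<1 : 0ℚ <ℚ 1ℚ
0<1 = *<* (ℤ.+<+ (s≤s z≤n))

shrink : ∀ {x y w} → 0ℚ <ℚ w → x <ℚ y *ℚ w → ∃[ s ] (s <ℚ y × x <ℚ s *ℚ w)
shrink {x} {y} {w} 0<w x<yw = s , s<y , subst (_<ℚ s *ℚ w) x/w*w
    (ℚP.*-monoˡ-<-pos w {{ℚ.positive 0<w}} x/w<s)
  where
  instance _ = ℚP.pos⇒nonZero w {{ℚ.positive 0<w}}
  x/w = x *ℚ ℚ.1/ w
  x/w*w : x/w *ℚ w ≡ x
  x/w*w = trans (ℚP.*-assoc x (ℚ.1/ w) w) (trans (cong (x *ℚ_) (ℚP.*-inverseˡ w)) (ℚP.*-identityʳ x))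
  x/w<y : x/w <ℚ y
  x/w<y = *-cancelʳ-< (ℚP.<⇒≤ 0<w) (subst (_<ℚ y *ℚ w) (sym x/w*w) x<yw)
  s = proj₁ (ℚP.<-dense x/w<y)
  x/w<s = proj₁ (proj₂ (ℚP.<-dense x/w<y))
  s<y = proj₂ (proj₂ (ℚP.<-dense x/w<y))

-- Powers

^-nonNeg : ∀ {x} → 0ℚ ≤ℚ x → ∀ n → 0ℚ ≤ℚ x ^ℚ n
^-nonNeg 0≤x zero    = 0≤1
^-nonNeg 0≤x (suc n) = *-nonNeg 0≤x (^-nonNeg 0≤x n)

^-pos : ∀ {x} → 0ℚ <ℚ x → ∀ n → 0ℚ <ℚ x ^ℚ n
^-pos 0<x zero    = 0<1
^-pos 0<x (suc n) = *-pos 0<x (^-pos 0<x n)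

^-monoˡ-≤ : ∀ {x y} → 0ℚ ≤ℚ x → x ≤ℚ y → ∀ n → x ^ℚ n ≤ℚ y ^ℚ n
^-monoˡ-≤ 0≤x x≤y zero    = ℚP.≤-refl
^-monoˡ-≤ 0≤x x≤y (suc n) = *-mono-≤ 0≤x (^-nonNeg 0≤x n) x≤y (^-monoˡ-≤ 0≤x x≤y n)

^-monoˡ-< : ∀ {x y} → 0ℚ ≤ℚ x → x <ℚ y → ∀ n .{{_ : NonZero n}} → x ^ℚ n <ℚ y ^ℚ n
^-monoˡ-< {x} {y} 0≤x x<y (suc zero) = subst₂ _<ℚ_ (sym (ℚP.*-identityʳ x)) (sym (ℚP.*-identityʳ y)) x<y
^-monoˡ-< 0≤x x<y (suc n@(suc _)) = *-mono-< 0≤x (^-nonNeg 0≤x n) x<y (^-monoˡ-< 0≤x x<y n)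

^-cancelˡ-< : ∀ {x y} → 0ℚ ≤ℚ y → ∀ n → x ^ℚ n <ℚ y ^ℚ n → x <ℚ y
^-cancelˡ-< 0≤y n xⁿ<yⁿ = ℚP.≰⇒> λ y≤x → ℚP.<-irrefl refl (ℚP.<-≤-trans xⁿ<yⁿ (^-monoˡ-≤ 0≤y y≤x n))

1≤^ : ∀ {x} → 1ℚ ≤ℚ x → ∀ n → 1ℚ ≤ℚ x ^ℚ n
1≤^ 1≤x zero    = ℚP.≤-refl
1≤^ {x} 1≤x (suc n) = subst (_≤ℚ x *ℚ x ^ℚ n) (ℚP.*-identityˡ 1ℚ) (*-mono-≤ 0≤1 0≤1 1≤x (1≤^ 1≤x n))

^≤1 : ∀ {x} → 0ℚ ≤ℚ x → x ≤ℚ 1ℚ → ∀ n → x ^ℚ n ≤ℚ 1ℚ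
^≤1 0≤x x≤1 zero    = ℚP.≤-refl
^≤1 {x} 0≤x x≤1 (suc n) = subst (x *ℚ x ^ℚ n ≤ℚ_) (ℚP.*-identityˡ 1ℚ)
  (*-mono-≤ 0≤x (^-nonNeg 0≤x n) x≤1 (^≤1 0≤x x≤1 n))

^-monoʳ-≤ : ∀ {x} → 1ℚ ≤ℚ x → ∀ {m n} → m ≤ n → x ^ℚ m ≤ℚ x ^ℚ n
^-monoʳ-≤ 1≤x {n = n} z≤n = 1≤^ 1≤x n
^-monoʳ-≤ 1≤x {suc m} (s≤s m≤n) =
  *-mono-≤ (ℚP.≤-trans 0≤1 1≤x) (^-nonNeg (ℚP.≤-trans 0≤1 1≤x) m) ℚP.≤-refl (^-monoʳ-≤ 1≤x m≤n)

^-swap : ∀ x m n → (x ^ℚ m) ^ℚ n ≡ (x ^ℚ n) ^ℚ m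
^-swap x m n = trans (^-assocʳ x m n) (trans (cong (x ^ℚ_) (ℕP.*-comm m n)) (sym (^-assocʳ x n m)))

-- Continuity of the powers at y.
root-approx : ∀ n {x y} → 1ℚ <ℚ y → x <ℚ y ^ℚ n → ∃[ s ] (1ℚ ≤ℚ s × s <ℚ y × x <ℚ s ^ℚ n)
root-approx zero    1<y x<1  = 1ℚ , ℚP.≤-refl , 1<y , x<1
root-approx (suc n) {x} {y} 1<y x<yⁿ⁺¹ =
  let 0<y = ℚP.<-trans 0<1 1<y
      -- The factor `y ^ n` is lowered to a power of `s₁` by induction, then the remaining `y` to
      -- `s₂`; the larger of the two serves for both.
      v , v<yⁿ , x<vy = shrink {x} {y ^ℚ n} {y} 0<y (subst (x <ℚ_) (ℚP.*-comm y (y ^ℚ n)) x<yⁿ⁺¹)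
      s₁ , 1≤s₁ , s₁<y , v<s₁ⁿ = root-approx n 1<y v<yⁿ
      0<s₁ = ℚP.<-≤-trans 0<1 1≤s₁
      x<ys₁ⁿ = ℚP.<-trans x<vy
        (subst (v *ℚ y <ℚ_) (ℚP.*-comm (s₁ ^ℚ n) y) (ℚP.*-monoˡ-<-pos y {{ℚ.positive 0<y}} v<s₁ⁿ))
      s₂ , s₂<y , x<s₂s₁ⁿ = shrink {x} {y} {s₁ ^ℚ n} (^-pos 0<s₁ n) x<ys₁ⁿ
      s , s₁≤s , s₂≤s , s<y = upper s₁<y s₂<y
  in s , ℚP.≤-trans 1≤s₁ s₁≤s , s<y , ℚP.<-≤-trans x<s₂s₁ⁿ (ℚP.≤-trans
       (ℚP.*-monoʳ-≤-nonNeg (s₁ ^ℚ n) {{ℚ.nonNegative (^-nonNeg (ℚP.<⇒≤ 0<s₁) n)}} s₂≤s)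
       (ℚP.*-monoˡ-≤-nonNeg s {{ℚ.nonNegative (ℚP.≤-trans (ℚP.<⇒≤ 0<s₁) s₁≤s)}} (^-monoˡ-≤ (ℚP.<⇒≤ 0<s₁) s₁≤s n)))
  where
  upper : ∀ {a b c} → a <ℚ c → b <ℚ c → ∃[ d ] (a ≤ℚ d × b ≤ℚ d × d <ℚ c)
  upper {a} {b} a<c b<c with ℚP.≤-total a b
  ... | inj₁ a≤b = b , a≤b , ℚP.≤-refl , b<c
  ... | inj₂ b≤a = a , ℚP.≤-refl , b≤a , a<c

-- The embedding of ℕ

-- `ℕ→ℚ m` normalises through a gcd and is stuck for variable `m`; rewriting by this form exposes
-- numerator and denominator.
ℕ→ℚ-mkℚ : ∀ m → ℕ→ℚ m ≡ mkℚ (ℤ.+ m) 0 (Coprimality.sym (Coprimality.1-coprimeTo m))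
ℕ→ℚ-mkℚ m = ℚP.normalize-coprime (Coprimality.sym (Coprimality.1-coprimeTo m))

num-ℕ→ℚ : ∀ m → num (ℕ→ℚ m) ≡ m
num-ℕ→ℚ m = cong num (ℕ→ℚ-mkℚ m)

↧-ℕ→ℚ : ∀ m → ↧ₙ (ℕ→ℚ m) ≡ 1
↧-ℕ→ℚ m = cong ↧ₙ_ (ℕ→ℚ-mkℚ m)

ℕ→ℚ-mono-≤ : ∀ {m n} → m ≤ n → ℕ→ℚ m ≤ℚ ℕ→ℚ n
ℕ→ℚ-mono-≤ {m} {n} m≤n rewrite ℕ→ℚ-mkℚ m | ℕ→ℚ-mkℚ n =
  *≤* (ℤP.*-monoʳ-≤-nonNeg (ℤ.+ 1) (ℤ.+≤+ m≤n))

ℕ→ℚ-mono-< : ∀ {m n} → m < n → ℕ→ℚ m <ℚ ℕ→ℚ n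
ℕ→ℚ-mono-< {m} {n} m<n rewrite ℕ→ℚ-mkℚ m | ℕ→ℚ-mkℚ n =
  *<* (ℤP.*-monoʳ-<-pos (ℤ.+ 1) (ℤ.+<+ m<n))

ℕ→ℚ-cancel-< : ∀ {m n} → ℕ→ℚ m <ℚ ℕ→ℚ n → m < n
ℕ→ℚ-cancel-< m<n = ℕP.≰⇒> λ n≤m → ℚP.<-irrefl refl (ℚP.<-≤-trans m<n (ℕ→ℚ-mono-≤ n≤m))

0≤ℕ→ℚ : ∀ m → 0ℚ ≤ℚ ℕ→ℚ m
0≤ℕ→ℚ m = ℕ→ℚ-mono-≤ {0} {m} z≤n

ℕ→ℚ-+ : ∀ m n → ℕ→ℚ (m + n) ≡ ℕ→ℚ m +ℚ ℕ→ℚ n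
ℕ→ℚ-+ m n rewrite ℕ→ℚ-mkℚ m | ℕ→ℚ-mkℚ n =
  cong (ℚ._/ 1) (sym (cong₂ ℤ._+_ (ℤP.*-identityʳ (ℤ.+ m)) (ℤP.*-identityʳ (ℤ.+ n))))

ℕ→ℚ-* : ∀ m n → ℕ→ℚ (m * n) ≡ ℕ→ℚ m *ℚ ℕ→ℚ n
ℕ→ℚ-* m n rewrite ℕ→ℚ-mkℚ m | ℕ→ℚ-mkℚ n = cong (ℚ._/ 1) (ℤP.pos-* m n)

ℕ→ℚ-^ : ∀ m n → ℕ→ℚ (m ^ n) ≡ ℕ→ℚ m ^ℚ n
ℕ→ℚ-^ m zero    = refl
ℕ→ℚ-^ m (suc n) = trans (ℕ→ℚ-* m (m ^ n)) (cong (ℕ→ℚ m *ℚ_) (ℕ→ℚ-^ m n))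

p*↧p≡num : ∀ {p} → 0ℚ ≤ℚ p → p *ℚ ℕ→ℚ (↧ₙ p) ≡ ℕ→ℚ (num p)
p*↧p≡num {mkℚ (ℤ.+ a) d c} 0≤p = ℚP.toℚᵘ-injective (begin
  ℚ.toℚᵘ (p *ℚ ℕ→ℚ (suc d))                   ≈⟨ ℚP.toℚᵘ-homo-* p (ℕ→ℚ (suc d)) ⟩
  ℚ.toℚᵘ p ℚᵘ.* ℚ.toℚᵘ (ℕ→ℚ (suc d))          ≡⟨ cong (λ q → ℚ.toℚᵘ p ℚᵘ.* ℚ.toℚᵘ q) (ℕ→ℚ-mkℚ (suc d)) ⟩
  ℚᵘ.mkℚᵘ (ℤ.+ a) d ℚᵘ.* ℚᵘ.mkℚᵘ (ℤ.+ suc d) 0    ≈⟨ ℚᵘ.*≡* (ℤP.*-assoc (ℤ.+ a) (ℤ.+ suc d) (ℤ.+ 1)) ⟩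
  ℚᵘ.mkℚᵘ (ℤ.+ a) 0                             ≡⟨ cong ℚ.toℚᵘ (ℕ→ℚ-mkℚ a) ⟨
  ℚ.toℚᵘ (ℕ→ℚ a)                              ∎)
  where
  open ℚᵘP.≃-Reasoning
  p = mkℚ (ℤ.+ a) d c
p*↧p≡num {mkℚ -[1+ a ] d c} (*≤* le) with () ← subst (ℤ._≤ -[1+ a ]  ℤ.* ℤ.+ 1) (ℤP.*-zeroˡ (ℤ.+ suc d)) le

module _ {p : ℚ} (0≤p : 0ℚ ≤ℚ p) where

  0<↧ : 0ℚ <ℚ ℕ→ℚ (↧ₙ p)
  0<↧ = ℕ→ℚ-mono-< {0} {↧ₙ p} (s≤s z≤n)

  num-<⁺ : ∀ c → p <ℚ ℕ→ℚ c → num p < c * ↧ₙ p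
  num-<⁺ c p<c = ℕ→ℚ-cancel-< (subst₂ _<ℚ_ (p*↧p≡num 0≤p) (sym (ℕ→ℚ-* c (↧ₙ p)))
    (ℚP.*-monoˡ-<-pos (ℕ→ℚ (↧ₙ p)) {{ℚ.positive 0<↧}} p<c))

  num-<⁻ : ∀ c → num p < c * ↧ₙ p → p <ℚ ℕ→ℚ c
  num-<⁻ c lt = *-cancelʳ-< (ℚP.<⇒≤ 0<↧)
    (subst₂ _<ℚ_ (sym (p*↧p≡num 0≤p)) (ℕ→ℚ-* c (↧ₙ p)) (ℕ→ℚ-mono-< lt))

  <-num⁺ : ∀ c → ℕ→ℚ c <ℚ p → c * ↧ₙ p < num p
  <-num⁺ c c<p = ℕ→ℚ-cancel-< (subst₂ _<ℚ_ (sym (ℕ→ℚ-* c (↧ₙ p))) (p*↧p≡num 0≤p)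
    (ℚP.*-monoˡ-<-pos (ℕ→ℚ (↧ₙ p)) {{ℚ.positive 0<↧}} c<p))

  <-num⁻ : ∀ c → c * ↧ₙ p < num p → ℕ→ℚ c <ℚ p
  <-num⁻ c lt = *-cancelʳ-< (ℚP.<⇒≤ 0<↧)
    (subst₂ _<ℚ_ (ℕ→ℚ-* c (↧ₙ p)) (sym (p*↧p≡num 0≤p)) (ℕ→ℚ-mono-< lt))

n<2^n : ∀ n → n < 2 ^ n
n<2^n zero    = s≤s z≤n
n<2^n (suc n) = ℕP.+-mono-≤ (ℕP.m^n>0 2 n) (ℕP.≤-trans (n<2^n n) (ℕP.m≤m+n (2 ^ n) 0))

2^-cancel-< : ∀ {m n} → 2 ^ m < 2 ^ n → m < n
2^-cancel-< lt = ℕP.≰⇒> λ n≤m → ℕP.<⇒≱ lt (ℕP.^-monoʳ-≤ 2 n≤m)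

1≤⇒0≤ : ∀ {x} → 1ℚ ≤ℚ x → 0ℚ ≤ℚ x
1≤⇒0≤ = ℚP.≤-trans 0≤1

1≤⇒0< : ∀ {x} → 1ℚ ≤ℚ x → 0ℚ <ℚ x
1≤⇒0< = ℚP.<-≤-trans 0<1

-- Consequences of lower bounds for logarithms and powers

log₂-lower : ∀ {r s} → 0ℚ ≤ℚ s → L (log₂ r) s → 2 ^ num s < r ^ ↧ₙ s
log₂-lower 0≤s (inj₁ s<0)      = ⊥-elim (ℚP.<-irrefl refl (ℚP.<-≤-trans s<0 0≤s))
log₂-lower 0≤s (inj₂ (_ , lt)) = lt

log₂-bound : ∀ {r s} V → 0ℚ ≤ℚ s → L (log₂ r) s → r < 2 ^ V → s <ℚ ℕ→ℚ V
log₂-bound {r} {s} V 0≤s Ls r<2^V = num-<⁻ 0≤s V (2^-cancel-< (begin-strict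
  2 ^ num s          <⟨ log₂-lower {r} 0≤s Ls ⟩
  r ^ ↧ₙ s           ≤⟨ ℕP.^-monoˡ-≤ (↧ₙ s) (ℕP.<⇒≤ r<2^V) ⟩
  (2 ^ V) ^ ↧ₙ s     ≡⟨ ℕP.^-*-assoc 2 V (↧ₙ s) ⟩
  2 ^ (V * ↧ₙ s)     ∎))
  where open ℕP.≤-Reasoning

-- For `q ≥ 1` the branch with base at most 1 is impossible, because its powers stay at most 1; what
-- is left approximates `y` from below.
^ʳ-lower : ∀ {x y q} → 1ℚ ≤ℚ q → L (x ^ʳ y) q →
  ∃[ s ] ∃[ p ] (L x s × 1ℚ ≤ℚ s × 0ℚ ≤ℚ p × L y p × q ^ℚ ↧ₙ p <ℚ s ^ℚ num p)
^ʳ-lower 1≤q (inj₁ q<0) = ⊥-elim (ℚP.<-irrefl refl (ℚP.<-≤-trans q<0 (1≤⇒0≤ 1≤q)))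
^ʳ-lower 1≤q (inj₂ (_ , s , p , Ls , _ , 0≤p , inj₁ (1≤s , Lp) , lt)) = s , p , Ls , 1≤s , 0≤p , Lp , lt
^ʳ-lower 1≤q (inj₂ (_ , s , p , Ls , 0<s , 0≤p , inj₂ (s≤1 , _) , lt)) =
  ⊥-elim (ℚP.<-irrefl refl (ℚP.<-≤-trans lt (ℚP.≤-trans (^≤1 (ℚP.<⇒≤ 0<s) s≤1 (num p)) (1≤^ 1≤q (↧ₙ p)))))

^ʳ-down : ∀ x y {q q′} → L (x ^ʳ y) q → q′ <ℚ q → L (x ^ʳ y) q′
^ʳ-down x y (inj₁ q<0) q′<q = inj₁ (ℚP.<-trans q′<q q<0)
^ʳ-down x y {q} {q′} (inj₂ (_ , s , p , Ls , 0<s , 0≤p , c , lt)) q′<q with q′ ℚP.<? 0ℚ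
... | yes q′<0 = inj₁ q′<0
... | no q′≮0  = inj₂ (0≤q′ , s , p , Ls , 0<s , 0≤p , c , ℚP.≤-<-trans (^-monoˡ-≤ 0≤q′ (ℚP.<⇒≤ q′<q) (↧ₙ p)) lt)
  where 0≤q′ = ℚP.≮⇒≥ q′≮0

-- A rational witness for c < (log₂ r)^α.
Below : ℕ → Cut → ℕ → Set
Below r α c = ∃[ s ] ∃[ t ]
  (L (log₂ r) s × 1ℚ ≤ℚ s × 0ℚ ≤ℚ t × L α t × ℕ→ℚ c ^ℚ ↧ₙ t <ℚ s ^ℚ num t)

below-mono : ∀ {r α c c′} → c ≤ c′ → Below r α c′ → Below r α c
below-mono {c = c} {c′} c≤c′ (s , t , Ls , 1≤s , 0≤t , Lt , lt) =
  s , t , Ls , 1≤s , 0≤t , Lt , ℚP.≤-<-trans (^-monoˡ-≤ (0≤ℕ→ℚ c) (ℕ→ℚ-mono-≤ {c} {c′} c≤c′) (↧ₙ t)) lt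

-- `α ≤ 1` gives `t ≤ 1`, hence `c < s ^ t ≤ s`, and `s` is below `log₂ r`.
below⇒2^< : ∀ {r α c} → α ≤ʳ fromℕ 1 → Below r α c → 2 ^ c < r
below⇒2^< {r} {α} {c} α≤1 (s , t , Ls , 1≤s , 0≤t , Lt , lt) =
  ℕP.≰⇒> λ r≤2^c → ℕP.<⇒≱ 2^c<r (subst (r ^ ↧ₙ s ≤_) (ℕP.^-*-assoc 2 c (↧ₙ s)) (ℕP.^-monoˡ-≤ (↧ₙ s) r≤2^c))
  where
  num≤↧ : num t ≤ ↧ₙ t
  num≤↧ = subst (num t ≤_) (ℕP.*-identityˡ (↧ₙ t)) (ℕP.<⇒≤ (num-<⁺ 0≤t 1 (α≤1 t Lt)))
  c<s : ℕ→ℚ c <ℚ s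
  c<s = ^-cancelˡ-< (1≤⇒0≤ 1≤s) (↧ₙ t) (ℚP.<-≤-trans lt (^-monoʳ-≤ 1≤s num≤↧))
  2^c<r : 2 ^ (c * ↧ₙ s) < r ^ ↧ₙ s
  2^c<r = ℕP.<-trans (ℕP.^-monoʳ-< 2 (s≤s (s≤s z≤n)) (<-num⁺ (1≤⇒0≤ 1≤s) c c<s))
                     (log₂-lower {r} (1≤⇒0≤ 1≤s) Ls)

power⇒below : ∀ {r α} c → 1 ≤ c → L (log₂ r ^ʳ α) (ℕ→ℚ c) → Below r α c
power⇒below {r} {α} c 1≤c = ^ʳ-lower {log₂ r} {α} (ℕ→ℚ-mono-≤ {1} {c} 1≤c)

2^-power-lower : ∀ {y} M → L (fromℕ 2 ^ʳ y) (ℕ→ℚ (2 ^ M)) → ∃[ p ] (L y p × ℕ→ℚ M <ℚ p)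
2^-power-lower {y} M h =
  let s , p , s<2 , 1≤s , 0≤p , Lp , lt = ^ʳ-lower {fromℕ 2} {y} (ℕ→ℚ-mono-≤ {1} {2 ^ M} (ℕP.m^n>0 2 M)) h
  in p , Lp , <-num⁻ 0≤p M (2^-cancel-< (ℕ→ℚ-cancel-< (begin-strict
       ℕ→ℚ (2 ^ (M * ↧ₙ p))        ≡⟨ cong ℕ→ℚ (ℕP.^-*-assoc 2 M (↧ₙ p)) ⟨
       ℕ→ℚ ((2 ^ M) ^ ↧ₙ p)        ≡⟨ ℕ→ℚ-^ (2 ^ M) (↧ₙ p) ⟩
       ℕ→ℚ (2 ^ M) ^ℚ ↧ₙ p         <⟨ lt ⟩
       s ^ℚ num p                  ≤⟨ ^-monoˡ-≤ (1≤⇒0≤ 1≤s) (ℚP.<⇒≤ s<2) (num p) ⟩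
       ℕ→ℚ 2 ^ℚ num p              ≡⟨ ℕ→ℚ-^ 2 (num p) ⟨
       ℕ→ℚ (2 ^ num p)             ∎)))
  where open ℚP.≤-Reasoning

nonNeg-lower : ∀ {α t} → fromℕ 0 <ʳ α → L α t → ∃[ t′ ] (0ℚ ≤ℚ t′ × L α t′ × t ≤ℚ t′)
nonNeg-lower {t = t} (q , 0<q , Lq) Lt with ℚP.≤-total t q
... | inj₁ t≤q = q , ℚP.<⇒≤ 0<q , Lq , t≤q
... | inj₂ q≤t = t , ℚP.≤-trans (ℚP.<⇒≤ 0<q) q≤t , Lt , ℚP.≤-refl

num-<-2+ : ∀ {p t} → 0ℚ ≤ℚ p → 0ℚ ≤ℚ t → p <ℚ ℕ→ℚ 2 +ℚ t →
  num p * ↧ₙ t < (2 * ↧ₙ t + num t) * ↧ₙ p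
num-<-2+ {p} {t} 0≤p 0≤t p<2+t = ℕ→ℚ-cancel-< (begin-strict
  ℕ→ℚ (num p * ↧ₙ t)                        ≡⟨ ℕ→ℚ-* (num p) (↧ₙ t) ⟩
  ℕ→ℚ (num p) *ℚ d                          ≡⟨ cong (_*ℚ d) (p*↧p≡num 0≤p) ⟨
  p *ℚ e *ℚ d                               ≡⟨ ℚP.*-assoc p e d ⟩
  p *ℚ (e *ℚ d)                             <⟨ ℚP.*-monoˡ-<-pos (e *ℚ d) {{ℚ.positive (*-pos (0<↧ 0≤p) (0<↧ 0≤t))}} p<2+t ⟩
  (ℕ→ℚ 2 +ℚ t) *ℚ (e *ℚ d)                  ≡⟨ cong ((ℕ→ℚ 2 +ℚ t) *ℚ_) (ℚP.*-comm e d) ⟩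
  (ℕ→ℚ 2 +ℚ t) *ℚ (d *ℚ e)                  ≡⟨ ℚP.*-assoc (ℕ→ℚ 2 +ℚ t) d e ⟨
  (ℕ→ℚ 2 +ℚ t) *ℚ d *ℚ e                    ≡⟨ cong (_*ℚ e) (ℚP.*-distribʳ-+ d (ℕ→ℚ 2) t) ⟩
  (ℕ→ℚ 2 *ℚ d +ℚ t *ℚ d) *ℚ e               ≡⟨ cong (_*ℚ e) (cong₂ _+ℚ_ (sym (ℕ→ℚ-* 2 (↧ₙ t))) (p*↧p≡num 0≤t)) ⟩
  (ℕ→ℚ (2 * ↧ₙ t) +ℚ ℕ→ℚ (num t)) *ℚ e      ≡⟨ cong (_*ℚ e) (ℕ→ℚ-+ (2 * ↧ₙ t) (num t)) ⟨
  ℕ→ℚ (2 * ↧ₙ t + num t) *ℚ e               ≡⟨ ℕ→ℚ-* (2 * ↧ₙ t + num t) (↧ₙ p) ⟨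
  ℕ→ℚ ((2 * ↧ₙ t + num t) * ↧ₙ p)           ∎)
  where
  open ℚP.≤-Reasoning
  d = ℕ→ℚ (↧ₙ t)
  e = ℕ→ℚ (↧ₙ p)

-- Here `s` approximates `log₂ r`. From `V² c ≤ X < s ^ p ≤ s ^ (2 + t)` and `s < V` a factor `V²`
-- cancels; the powers `d` and `e` clear denominators.
below-from-power : ∀ {X s p t} V c → 0ℚ ≤ℚ X → 1ℚ ≤ℚ s → 0ℚ ≤ℚ p → 0ℚ ≤ℚ t → p <ℚ ℕ→ℚ 2 +ℚ t → s <ℚ ℕ→ℚ V →
  ℕ→ℚ (V ^ 2 * c) ≤ℚ X → X ^ℚ ↧ₙ p <ℚ s ^ℚ num p → ℕ→ℚ c ^ℚ ↧ₙ t <ℚ s ^ℚ num t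
below-from-power {X} {s} {p} {t} V c 0≤X 1≤s 0≤p 0≤t p<2+t s<V VVc≤X X^e<s^f =
  *-cancelˡ-< {c = ℕ→ℚ (V ^ 2) ^ℚ d} (^-nonNeg (0≤ℕ→ℚ (V ^ 2)) d) (begin-strict
    ℕ→ℚ (V ^ 2) ^ℚ d *ℚ ℕ→ℚ c ^ℚ d     ≡⟨ ^-distrib-* (ℕ→ℚ (V ^ 2)) (ℕ→ℚ c) d ⟨
    (ℕ→ℚ (V ^ 2) *ℚ ℕ→ℚ c) ^ℚ d        ≡⟨ cong (_^ℚ d) (ℕ→ℚ-* (V ^ 2) c) ⟨
    ℕ→ℚ (V ^ 2 * c) ^ℚ d               ≤⟨ ^-monoˡ-≤ (0≤ℕ→ℚ (V ^ 2 * c)) VVc≤X d ⟩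
    X ^ℚ d                             <⟨ X^d<s^2d+a ⟩
    s ^ℚ (2 * d + a)                   ≡⟨ ^-homo-* s (2 * d) a ⟩
    s ^ℚ (2 * d) *ℚ s ^ℚ a             ≡⟨ cong (_*ℚ s ^ℚ a) (^-assocʳ s 2 d) ⟨
    (s ^ℚ 2) ^ℚ d *ℚ s ^ℚ a            ≤⟨ ℚP.*-monoʳ-≤-nonNeg (s ^ℚ a) {{ℚ.nonNegative (^-nonNeg 0≤s a)}}
                                           (^-monoˡ-≤ (^-nonNeg 0≤s 2) s²≤V² d) ⟩
    ℕ→ℚ (V ^ 2) ^ℚ d *ℚ s ^ℚ a         ∎)
  where
  open ℚP.≤-Reasoning
  d = ↧ₙ t
  a = num t
  e = ↧ₙ p
  f = num p
  0≤s = 1≤⇒0≤ 1≤s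

  s²≤V² : s ^ℚ 2 ≤ℚ ℕ→ℚ (V ^ 2)
  s²≤V² = subst (s ^ℚ 2 ≤ℚ_) (sym (ℕ→ℚ-^ V 2)) (^-monoˡ-≤ 0≤s (ℚP.<⇒≤ s<V) 2)

  X^d<s^2d+a : X ^ℚ d <ℚ s ^ℚ (2 * d + a)
  X^d<s^2d+a = ^-cancelˡ-< (^-nonNeg 0≤s (2 * d + a)) e (begin-strict
    (X ^ℚ d) ^ℚ e                ≡⟨ ^-swap X d e ⟩
    (X ^ℚ e) ^ℚ d                <⟨ ^-monoˡ-< (^-nonNeg 0≤X e) X^e<s^f d ⟩
    (s ^ℚ f) ^ℚ d                ≡⟨ ^-assocʳ s f d ⟩
    s ^ℚ (f * d)                 ≤⟨ ^-monoʳ-≤ 1≤s (ℕP.<⇒≤ (num-<-2+ 0≤p 0≤t p<2+t)) ⟩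
    s ^ℚ ((2 * d + a) * e)       ≡⟨ ^-assocʳ s (2 * d + a) e ⟨
    (s ^ℚ (2 * d + a)) ^ℚ e      ∎)

-- The exponent exceeds `M`, so `(log r)^(2+α) > 200 M ≥ V² c`, while `log r < V`. Applied with
-- `2 ^ M < n`, this extracts a bound on `(log r)^α` from the size of `n`. `1 ≤ M` gives the `X ≥ 1`
-- that `^ʳ-lower` asks for.
size⇒below : ∀ {r α} V M c → fromℕ 0 <ʳ α → r < 2 ^ V → 1 ≤ M → V ^ 2 * c ≤ M * 200 →
  L (fromℕ 2 ^ʳ (log₂ r ^ʳ (fromℕ 2 +ʳ α) /ʳ 200)) (ℕ→ℚ (2 ^ M)) → Below r α c
size⇒below {r} {α} V M c 0<α r<2^V 1≤M bound h =
  let p , Lp , M<p = 2^-power-lower {log₂ r ^ʳ (fromℕ 2 +ʳ α) /ʳ 200} M h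
      X = p *ℚ ℕ→ℚ 200
      M200<X : ℕ→ℚ (M * 200) <ℚ X
      M200<X = subst (_<ℚ X) (sym (ℕ→ℚ-* M 200)) (ℚP.*-monoˡ-<-pos (ℕ→ℚ 200) M<p)
      1≤X = ℚP.≤-trans (ℕ→ℚ-mono-≤ {1} {M * 200} (ℕP.*-mono-≤ 1≤M (s≤s z≤n))) (ℚP.<⇒≤ M200<X)
      s , q , Ls , 1≤s , 0≤q , (s₂ , t₀ , s₂<2 , Lt₀ , q<s₂+t₀) , lt = ^ʳ-lower {log₂ r} {fromℕ 2 +ʳ α} 1≤X Lp
      t , 0≤t , Lt , t₀≤t = nonNeg-lower {α} 0<α Lt₀
  in s , t , Ls , 1≤s , 0≤t , Lt ,
     below-from-power V c (1≤⇒0≤ 1≤X) 1≤s 0≤q 0≤t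
       (ℚP.<-trans q<s₂+t₀ (ℚP.+-mono-<-≤ s₂<2 t₀≤t)) (log₂-bound {r} V (1≤⇒0≤ 1≤s) Ls r<2^V)
       (ℚP.≤-trans (ℕ→ℚ-mono-≤ {V ^ 2 * c} {M * 200} bound) (ℚP.<⇒≤ M200<X)) lt

-- Lower bounds for the exponent

-- This is `s ≤ x`, where `L x s` would be `s < x`; `log₂ (2 * k)` can equal the integer `l`.
Lower : Cut → ℚ → Set
Lower x s = ∀ q → q <ℚ s → L x q

*ʳ-Lower : ∀ {x y s t} → 0ℚ <ℚ s → 0ℚ <ℚ t → Lower x s → Lower y t → Lower (x *ʳ y) (s *ℚ t)
*ʳ-Lower {x} {y} {s} {t} 0<s 0<t Lx Ly q q<st with q ℚP.<? 0ℚ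
... | yes q<0 = inj₁ q<0
... | no q≮0 =
  let 0≤q = ℚP.≮⇒≥ q≮0
      s′ , s′<s , q<s′t = shrink {q} {s} {t} 0<t q<st
      0<s′ = *-cancelʳ-< {0ℚ} {s′} {t} (ℚP.<⇒≤ 0<t)
               (subst (_<ℚ s′ *ℚ t) (sym (ℚP.*-zeroˡ t)) (ℚP.≤-<-trans 0≤q q<s′t))
      t′ , t′<t , q<t′s′ = shrink {q} {t} {s′} 0<s′ (subst (q <ℚ_) (ℚP.*-comm s′ t) q<s′t)
      0<t′ = *-cancelʳ-< {0ℚ} {t′} {s′} (ℚP.<⇒≤ 0<s′)
               (subst (_<ℚ t′ *ℚ s′) (sym (ℚP.*-zeroˡ s′)) (ℚP.≤-<-trans 0≤q q<t′s′))
  in inj₂ (s′ , t′ , ℚP.<⇒≤ 0<s′ , ℚP.<⇒≤ 0<t′ , Lx s′ s′<s , Ly t′ t′<t ,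
           subst (q <ℚ_) (ℚP.*-comm t′ s′) q<t′s′)

√-Lower : ∀ {x s} → 0ℚ ≤ℚ s → Lower x (s *ℚ s) → Lower (√ x) s
√-Lower {x} {s} 0≤s Lx q q<s with q ℚP.<? 0ℚ
... | yes q<0 = inj₁ q<0
... | no q≮0  = inj₂ (ℚP.≮⇒≥ q≮0 , Lx (q *ℚ q) (*-mono-< (ℚP.≮⇒≥ q≮0) (ℚP.≮⇒≥ q≮0) q<s q<s))

log₂-Lower : ∀ {m} l → 2 ^ l ≤ m → Lower (log₂ m) (ℕ→ℚ l)
log₂-Lower {m} l 2^l≤m q q<l with q ℚP.<? 0ℚ
... | yes q<0 = inj₁ q<0
... | no q≮0  = inj₂ (0≤q , (begin-strict
  2 ^ num q         <⟨ ℕP.^-monoʳ-< 2 (s≤s (s≤s z≤n)) (num-<⁺ 0≤q l q<l) ⟩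
  2 ^ (l * ↧ₙ q)    ≡⟨ ℕP.^-*-assoc 2 l (↧ₙ q) ⟨
  (2 ^ l) ^ ↧ₙ q    ≤⟨ ℕP.^-monoˡ-≤ (↧ₙ q) 2^l≤m ⟩
  m ^ ↧ₙ q          ∎))
  where
  open ℕP.≤-Reasoning
  0≤q = ℚP.≮⇒≥ q≮0

half*2 : ∀ t → t *ℚ ½ *ℚ ℕ→ℚ 2 ≡ t
half*2 t = trans (ℚP.*-assoc t ½ (ℕ→ℚ 2)) (ℚP.*-identityʳ t)

half-nonNeg : ∀ {t} → 0ℚ ≤ℚ t → 0ℚ ≤ℚ t *ℚ ½
half-nonNeg 0≤t = *-nonNeg 0≤t (from-yes (0ℚ ℚP.≤? ½))

-- Halving may cancel a factor 2, so numerator and denominator of `t *ℚ ½` are accessible only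
-- through this cross product.
num-half : ∀ {t} → 0ℚ ≤ℚ t → num t * ↧ₙ (t *ℚ ½) ≡ num (t *ℚ ½) * (2 * ↧ₙ t)
num-half {t} 0≤t = ℕ→ℚ-injective (begin
  ℕ→ℚ (num t * ↧ₙ h)                  ≡⟨ ℕ→ℚ-* (num t) (↧ₙ h) ⟩
  ℕ→ℚ (num t) *ℚ e                    ≡⟨ cong (_*ℚ e) (p*↧p≡num 0≤t) ⟨
  t *ℚ d *ℚ e                         ≡⟨ cong (λ x → x *ℚ d *ℚ e) (half*2 t) ⟨
  h *ℚ two *ℚ d *ℚ e                  ≡⟨ cong (_*ℚ e) (ℚP.*-assoc h two d) ⟩
  h *ℚ (two *ℚ d) *ℚ e                ≡⟨ ℚP.*-assoc h (two *ℚ d) e ⟩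
  h *ℚ ((two *ℚ d) *ℚ e)              ≡⟨ cong (h *ℚ_) (ℚP.*-comm (two *ℚ d) e) ⟩
  h *ℚ (e *ℚ (two *ℚ d))              ≡⟨ ℚP.*-assoc h e (two *ℚ d) ⟨
  h *ℚ e *ℚ (two *ℚ d)                ≡⟨ cong₂ _*ℚ_ (p*↧p≡num (half-nonNeg 0≤t)) (sym (ℕ→ℚ-* 2 (↧ₙ t))) ⟩
  ℕ→ℚ (num h) *ℚ ℕ→ℚ (2 * ↧ₙ t)       ≡⟨ ℕ→ℚ-* (num h) (2 * ↧ₙ t) ⟨
  ℕ→ℚ (num h * (2 * ↧ₙ t))            ∎)
  where
  open ≡-Reasoning
  h = t *ℚ ½
  d = ℕ→ℚ (↧ₙ t)
  e = ℕ→ℚ (↧ₙ h)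
  two = ℕ→ℚ 2
  ℕ→ℚ-injective : ∀ {m n} → ℕ→ℚ m ≡ ℕ→ℚ n → m ≡ n
  ℕ→ℚ-injective {m} {n} eq = trans (sym (num-ℕ→ℚ m)) (trans (cong num eq) (num-ℕ→ℚ n))

-- `b ≤ √c < s ^ (t / 2)`, compared after raising to the power `2 * d`.
below⇒root : ∀ {r α} c b → b * b ≤ c → Below r α c → L (log₂ r ^ʳ (α /ʳ 2)) (ℕ→ℚ b)
below⇒root {r} {α} c b b²≤c (s , t , Ls , 1≤s , 0≤t , Lt , lt) =
  inj₂ (0≤ℕ→ℚ b , s , h , Ls , 1≤⇒0< 1≤s , half-nonNeg 0≤t , inj₁ (1≤s , subst (L α) (sym (half*2 t)) Lt) ,
    ^-cancelˡ-< (^-nonNeg 0≤s (num h)) (2 * d) (begin-strict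
      (ℕ→ℚ b ^ℚ e) ^ℚ (2 * d)         ≡⟨ ^-swap (ℕ→ℚ b) e (2 * d) ⟩
      (ℕ→ℚ b ^ℚ (2 * d)) ^ℚ e         ≡⟨ cong (_^ℚ e) (^-assocʳ (ℕ→ℚ b) 2 d) ⟨
      ((ℕ→ℚ b ^ℚ 2) ^ℚ d) ^ℚ e        ≤⟨ ^-monoˡ-≤ (^-nonNeg (^-nonNeg 0≤b 2) d) (^-monoˡ-≤ (^-nonNeg 0≤b 2) b²≤c′ d) e ⟩
      (ℕ→ℚ c ^ℚ d) ^ℚ e               <⟨ ^-monoˡ-< (^-nonNeg (0≤ℕ→ℚ c) d) lt e ⟩
      (s ^ℚ num t) ^ℚ e               ≡⟨ ^-assocʳ s (num t) e ⟩
      s ^ℚ (num t * e)                ≡⟨ cong (s ^ℚ_) (num-half 0≤t) ⟩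
      s ^ℚ (num h * (2 * d))          ≡⟨ ^-assocʳ s (num h) (2 * d) ⟨
      (s ^ℚ num h) ^ℚ (2 * d)         ∎))
  where
  open ℚP.≤-Reasoning
  h = t *ℚ ½
  d = ↧ₙ t
  e = ↧ₙ h
  0≤s = 1≤⇒0≤ 1≤s
  0≤b = 0≤ℕ→ℚ b
  b²≤c′ : ℕ→ℚ b ^ℚ 2 ≤ℚ ℕ→ℚ c
  b²≤c′ = subst (_≤ℚ ℕ→ℚ c) (ℕ→ℚ-^ b 2)
    (ℕ→ℚ-mono-≤ {b ^ 2} {c} (subst (_≤ c) (cong (b *_) (sym (ℕP.*-identityʳ b))) b²≤c))

fraction : ∀ g h .{{_ : NonZero h}} → ∃[ τ ] (τ *ℚ ℕ→ℚ h ≡ ℕ→ℚ g)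
fraction g (suc h) = ℕ→ℚ g *ℚ ℚ.1/ H , trans (ℚP.*-assoc (ℕ→ℚ g) (ℚ.1/ H) H)
    (trans (cong (ℕ→ℚ g *ℚ_) (ℚP.*-inverseˡ H)) (ℚP.*-identityʳ (ℕ→ℚ g)))
  where
  H = ℕ→ℚ (suc h)
  instance _ = ℚP.pos⇒nonZero H {{ℚ.positive (ℕ→ℚ-mono-< {0} {suc h} (s≤s z≤n))}}

-- The harmonic mean of z/w and wY/z lies between z/w and √Y.
between : ∀ z w Y → 1 ≤ z → z * z < w * w * Y →
  ∃[ τ ] (0ℚ <ℚ τ × τ *ℚ τ ≤ℚ ℕ→ℚ Y × ℕ→ℚ z <ℚ ℕ→ℚ w *ℚ τ)
between z@(suc _) w Y 1≤z z²<w²Y = τ , 0<τ , τ²≤Y , z<wτ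
  where
  q = w * w * Y
  g = 2 * z * w * Y
  h = z * z + q
  G = ℕ→ℚ g
  H = ℕ→ℚ h
  τ = proj₁ (fraction g h)
  τH : τ *ℚ H ≡ G
  τH = proj₂ (fraction g h)
  0<H : 0ℚ <ℚ H
  0<H = ℕ→ℚ-mono-< {0} {h} (s≤s z≤n)

  zh<wg : z * h < w * g
  zh<wg = begin-strict
    z * (z * z + q)   <⟨ ℕP.*-monoʳ-< z (ℕP.+-monoˡ-< q z²<w²Y) ⟩
    z * (q + q)       ≡⟨ eq z w Y ⟩
    w * g             ∎
    where
    open ℕP.≤-Reasoning
    eq : ∀ z w Y → z * (w * w * Y + w * w * Y) ≡ w * (2 * z * w * Y)
    eq = solve-∀

  amgm : ∀ p q → p ≤ q → 4 * (p * q) ≤ (p + q) * (p + q)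
  amgm p q p≤q with e , refl ← ℕP.m≤n⇒∃[o]m+o≡n p≤q = begin
    4 * (p * (p + e))                    ≤⟨ ℕP.m≤m+n _ (e * e) ⟩
    4 * (p * (p + e)) + e * e            ≡⟨ eq p e ⟩
    (p + (p + e)) * (p + (p + e))        ∎
    where
    open ℕP.≤-Reasoning
    eq : ∀ p e → 4 * (p * (p + e)) + e * e ≡ (p + (p + e)) * (p + (p + e))
    eq = solve-∀

  -- `g * g` is `Y` times `4 z² q`, so this is the inequality of the means for `z²` and `q`.
  g²≤Yh² : g * g ≤ Y * (h * h)
  g²≤Yh² = subst (_≤ Y * (h * h)) (eq z w Y) (ℕP.*-monoʳ-≤ Y (amgm (z * z) q (ℕP.<⇒≤ z²<w²Y)))
    where
    eq : ∀ z w Y → Y * (4 * (z * z * (w * w * Y))) ≡ 2 * z * w * Y * (2 * z * w * Y)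
    eq = solve-∀

  z<wτ : ℕ→ℚ z <ℚ ℕ→ℚ w *ℚ τ
  z<wτ = *-cancelʳ-< (ℚP.<⇒≤ 0<H) (begin-strict
    ℕ→ℚ z *ℚ H            ≡⟨ ℕ→ℚ-* z h ⟨
    ℕ→ℚ (z * h)           <⟨ ℕ→ℚ-mono-< {z * h} {w * g} zh<wg ⟩
    ℕ→ℚ (w * g)           ≡⟨ ℕ→ℚ-* w g ⟩
    ℕ→ℚ w *ℚ G            ≡⟨ cong (ℕ→ℚ w *ℚ_) τH ⟨
    ℕ→ℚ w *ℚ (τ *ℚ H)     ≡⟨ ℚP.*-assoc (ℕ→ℚ w) τ H ⟨
    ℕ→ℚ w *ℚ τ *ℚ H       ∎)
    where open ℚP.≤-Reasoning

  0<τ : 0ℚ <ℚ τ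
  0<τ = *-cancelˡ-< (0≤ℕ→ℚ w) (subst (_<ℚ ℕ→ℚ w *ℚ τ) (sym (ℚP.*-zeroʳ (ℕ→ℚ w)))
          (ℚP.≤-<-trans (0≤ℕ→ℚ z) z<wτ))

  τ²≤Y : τ *ℚ τ ≤ℚ ℕ→ℚ Y
  τ²≤Y = ℚP.*-cancelʳ-≤-pos (H *ℚ H) {{ℚ.positive (*-pos 0<H 0<H)}} (begin
    τ *ℚ τ *ℚ (H *ℚ H)        ≡⟨ ℚP.*-assoc τ τ (H *ℚ H) ⟩
    τ *ℚ (τ *ℚ (H *ℚ H))      ≡⟨ cong (τ *ℚ_) (trans (sym (ℚP.*-assoc τ H H)) (ℚP.*-comm (τ *ℚ H) H)) ⟩
    τ *ℚ (H *ℚ (τ *ℚ H))      ≡⟨ ℚP.*-assoc τ H (τ *ℚ H) ⟨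
    τ *ℚ H *ℚ (τ *ℚ H)        ≡⟨ cong₂ _*ℚ_ τH τH ⟩
    G *ℚ G                    ≡⟨ ℕ→ℚ-* g g ⟨
    ℕ→ℚ (g * g)               ≤⟨ ℕ→ℚ-mono-≤ {g * g} {Y * (h * h)} g²≤Yh² ⟩
    ℕ→ℚ (Y * (h * h))         ≡⟨ trans (ℕ→ℚ-* Y (h * h)) (cong (ℕ→ℚ Y *ℚ_) (ℕ→ℚ-* h h)) ⟩
    ℕ→ℚ Y *ℚ (H *ℚ H)         ∎)
    where open ℚP.≤-Reasoning

-- The premise `z < 3 b √(kl)` is strict, so `between` finds a rational `τ` in place of the root,
-- and the factors can be bounded one by one.
exponent-lower : ∀ {r y} b k l z → 1 ≤ b → 1 ≤ k → 1 ≤ l → 1 ≤ z → 2 ^ l ≤ 2 * k →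
  z * z < 3 * b * (3 * b) * (k * l) → L (log₂ r ^ʳ y) (ℕ→ℚ b) →
  L (fromℕ 3 *ʳ log₂ r ^ʳ y *ʳ √ (fromℕ k *ʳ log₂ (2 * k))) (ℕ→ℚ z)
exponent-lower {r} {y} b k l z 1≤b 1≤k 1≤l 1≤z 2^l≤2k z²< Lb =
  let τ , 0<τ , τ²≤kl , z<3bτ = between z (3 * b) (k * l) 1≤z z²<
      0<b = pos b 1≤b
      L₁ : Lower (fromℕ 3 *ʳ log₂ r ^ʳ y) (ℕ→ℚ 3 *ℚ ℕ→ℚ b)
      L₁ = *ʳ-Lower {fromℕ 3} {log₂ r ^ʳ y} (pos 3 (s≤s z≤n)) 0<b (λ _ q<3 → q<3) (λ _ → ^ʳ-down (log₂ r) y Lb)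
      L₂ : Lower (fromℕ k *ʳ log₂ (2 * k)) (ℕ→ℚ k *ℚ ℕ→ℚ l)
      L₂ = *ʳ-Lower {fromℕ k} {log₂ (2 * k)} (pos k 1≤k) (pos l 1≤l) (λ _ q<k → q<k) (log₂-Lower l 2^l≤2k)
      L₃ : Lower (√ (fromℕ k *ʳ log₂ (2 * k))) τ
      L₃ = √-Lower {fromℕ k *ʳ log₂ (2 * k)} (ℚP.<⇒≤ 0<τ) λ q q<τ² →
        L₂ q (ℚP.<-≤-trans q<τ² (subst (τ *ℚ τ ≤ℚ_) (ℕ→ℚ-* k l) τ²≤kl))
  in *ʳ-Lower {fromℕ 3 *ʳ log₂ r ^ʳ y} {√ (fromℕ k *ʳ log₂ (2 * k))} (*-pos (pos 3 (s≤s z≤n)) 0<b) 0<τ L₁ L₃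
       (ℕ→ℚ z) (subst (λ x → ℕ→ℚ z <ℚ x *ℚ τ) (ℕ→ℚ-* 3 b) z<3bτ)
  where
  pos : ∀ m → 1 ≤ m → 0ℚ <ℚ ℕ→ℚ m
  pos m = ℕ→ℚ-mono-< {0} {m}

-- The exponent is approximated by `z` itself, but the base only by rationals `s < 2`; `root-approx`
-- finds one with `q < s ^ z`.
≤-2^ : ∀ {y} j z → j ≤ 2 ^ z → L y (ℕ→ℚ z) → fromℕ j ≤ʳ (fromℕ 2 ^ʳ y)
≤-2^ {y} j z j≤2^z Lz q q<j with q ℚP.<? 0ℚ
... | yes q<0 = inj₁ q<0
... | no q≮0 =
  let s , 1≤s , s<2 , q<sᶻ = root-approx z {q} {ℕ→ℚ 2} (from-yes (1ℚ ℚP.<? ℕ→ℚ 2))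
        (ℚP.<-≤-trans q<j (subst (ℕ→ℚ j ≤ℚ_) (ℕ→ℚ-^ 2 z) (ℕ→ℚ-mono-≤ {j} {2 ^ z} j≤2^z)))
  in inj₂ (ℚP.≮⇒≥ q≮0 , s , ℕ→ℚ z , s<2 , 1≤⇒0< 1≤s , 0≤ℕ→ℚ z , inj₁ (1≤s , Lz) ,
       subst₂ (λ d a → q ^ℚ d <ℚ s ^ℚ a) (sym (↧-ℕ→ℚ z)) (sym (num-ℕ→ℚ z))
         (subst (_<ℚ s ^ℚ z) (sym (ℚP.*-identityʳ q)) q<sᶻ))

-- For I = ∅ the exponent is 0; it has no nonnegative lower approximations, so that 2⁰ is
-- approximated from below by powers 1 ^ p with p above the exponent.

log₂^-upper : ∀ {r α} → 1 ≤ r → IsReal α → fromℕ 0 <ʳ α → ∃[ q ] (0ℚ <ℚ q × U (log₂ r ^ʳ (α /ʳ 2)) q)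
log₂^-upper {r} {α} 1≤r real (q₀ , 0<q₀ , Lq₀) = q , 0<q ,
  (0<q , s , p , Us , 0<s , half-nonNeg 0≤p₀ , inj₁ (1≤s , subst (U α) (sym (half*2 p₀)) Up₀) , lt)
  where
  open IsReal real
  p₀ = proj₁ U-inhabited
  Up₀ = proj₂ U-inhabited
  0≤p₀ : 0ℚ ≤ℚ p₀
  0≤p₀ = ℚP.≮⇒≥ λ p₀<0 →
    disjoint p₀ (Equivalence.from (L-rounded p₀) (q₀ , ℚP.<-trans p₀<0 0<q₀ , Lq₀) , Up₀)
  p = p₀ *ℚ ½
  -- `r` is an upper approximation of `log₂ r` because `r < 2 ^ r`. Adding 1 to `s ^ num p` makes
  -- the bound strict, and `q ≥ 1` gives `q ≤ q ^ ↧ₙ p`.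
  s = ℕ→ℚ r
  1≤s = ℕ→ℚ-mono-≤ {1} {r} 1≤r
  0<s = 1≤⇒0< {s} 1≤s
  q = s ^ℚ num p +ℚ 1ℚ
  s^<q : s ^ℚ num p <ℚ q
  s^<q = subst (_<ℚ q) (ℚP.+-identityʳ (s ^ℚ num p)) (ℚP.+-monoʳ-< (s ^ℚ num p) 0<1)
  1≤q : 1ℚ ≤ℚ q
  1≤q = ℚP.≤-trans (1≤^ 1≤s (num p)) (ℚP.<⇒≤ s^<q)
  0<q = 1≤⇒0< 1≤q
  lt : s ^ℚ num p <ℚ q ^ℚ ↧ₙ p
  lt = ℚP.<-≤-trans s^<q (subst (_≤ℚ q ^ℚ ↧ₙ p) (ℚP.*-identityʳ q) (^-monoʳ-≤ 1≤q {1} {↧ₙ p} (s≤s z≤n)))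
  Us : U (log₂ r) s
  Us = 0<s , subst₂ (λ d a → r ^ d < 2 ^ a) (sym (↧-ℕ→ℚ r)) (sym (num-ℕ→ℚ r))
    (subst (_< 2 ^ r) (sym (ℕP.*-identityʳ r)) (n<2^n r))

≤-2^0 : ∀ {r α} j → 1 ≤ r → IsReal α → fromℕ 0 <ʳ α → j ≤ 1 →
  fromℕ j ≤ʳ (fromℕ 2 ^ʳ (fromℕ 3 *ʳ log₂ r ^ʳ (α /ʳ 2) *ʳ √ (fromℕ 0 *ʳ log₂ (2 * 0))))
≤-2^0 {r} {α} j 1≤r real 0<α j≤1 q q<j with q ℚP.<? 0ℚ
... | yes q<0 = inj₁ q<0
... | no q≮0  =
  let b , 0<b , Ub = log₂^-upper {r} {α} 1≤r real 0<α
      -- As the base is 1, any upper approximation of the exponent serves: 4 for the factor 3, `b`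
      -- for the power of the logarithm, 2 for the root, with 1 added after each product for
      -- strictness.
      four = ℕ→ℚ 4
      two  = ℕ→ℚ 2
      a = four *ℚ b +ℚ 1ℚ
      p = a *ℚ two +ℚ 1ℚ
      4b<a = above (four *ℚ b)
      0<a  = ℚP.<-trans (*-pos (from-yes (0ℚ ℚP.<? four)) 0<b) 4b<a
      2a<p = above (a *ℚ two)
      0<p  = ℚP.<-trans (*-pos 0<a (from-yes (0ℚ ℚP.<? two))) 2a<p
      U√ : U (√ (fromℕ 0 *ʳ log₂ (2 * 0))) two
      U√ = from-yes (0ℚ ℚP.<? two) , 1ℚ , 1ℚ , 0<1 , (0<1 , s≤s z≤n) , from-yes (1ℚ *ℚ 1ℚ ℚP.<? two *ℚ two)
  in inj₂ (0≤q , 1ℚ , p , from-yes (1ℚ ℚP.<? two) , 0<1 , ℚP.<⇒≤ 0<p ,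
       inj₂ (ℚP.≤-refl , a , two , (four , b , from-yes (ℕ→ℚ 3 ℚP.<? four) , Ub , 4b<a) , U√ , 2a<p) ,
       ℚP.<-≤-trans (^-monoˡ-< 0≤q q<1 (↧ₙ p)) (ℚP.≤-trans (^≤1 0≤1 ℚP.≤-refl (↧ₙ p)) (1≤^ ℚP.≤-refl (num p))))
  where
  0≤q = ℚP.≮⇒≥ q≮0
  q<1 : q <ℚ 1ℚ
  q<1 = ℚP.<-≤-trans q<j (ℕ→ℚ-mono-≤ {j} {1} j≤1)
  above : ∀ x → x <ℚ x +ℚ 1ℚ
  above x = subst (_<ℚ x +ℚ 1ℚ) (ℚP.+-identityʳ x) (ℚP.+-monoʳ-< x 0<1)

-- Supplies the integer roundings below: of logarithms, of square roots and of the number of blocks.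
last-below : ∀ {P : ℕ → Set} → Decidable P → P 0 → ∀ N → ¬ P N → ∃[ i ] (P i × ¬ P (suc i))
last-below P? P0 zero    ¬PN = contradiction P0 ¬PN
last-below P? P0 (suc N) ¬PN with P? N
... | yes PN = N , PN , ¬PN
... | no ¬PN′ = last-below P? P0 N ¬PN′

-- The choice of the parameter D

square-cancel-< : ∀ {m n} → m * m < n * n → m < n
square-cancel-< lt = ℕP.≰⇒> λ n≤m → ℕP.<⇒≱ lt (ℕP.*-mono-≤ n≤m n≤m)

-- `Y² ≤ 4 Y G`, `G² ≤ Y G` and the cross term add up to `7 Y G`. The 9 becomes the square of the
-- constant 3 in the exponent of the theorem.
square-sum : ∀ Y G → 1 ≤ G → G ≤ Y → Y ≤ 4 * G → (Y + G) * (Y + G) < 9 * (Y * G)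
square-sum Y G 1≤G G≤Y Y≤4G = begin-strict
  (Y + G) * (Y + G)                          ≡⟨ expand Y G ⟩
  Y * Y + (2 * (Y * G) + G * G)              ≤⟨ ℕP.+-mono-≤ (ℕP.*-monoʳ-≤ Y Y≤4G)
                                                  (ℕP.+-monoʳ-≤ (2 * (Y * G)) (ℕP.*-monoˡ-≤ G G≤Y)) ⟩
  Y * (4 * G) + (2 * (Y * G) + Y * G)        <⟨ ℕP.m<m+n _ (ℕP.*-mono-≤ (s≤s (z≤n {1}))
                                                  (ℕP.*-mono-≤ (ℕP.≤-trans 1≤G G≤Y) 1≤G)) ⟩
  Y * (4 * G) + (2 * (Y * G) + Y * G) + 2 * (Y * G)  ≡⟨ collect Y G ⟩
  9 * (Y * G)                                ∎
  where
  open ℕP.≤-Reasoning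
  expand : ∀ Y G → (Y + G) * (Y + G) ≡ Y * Y + (2 * (Y * G) + G * G)
  expand = solve-∀
  collect : ∀ Y G → Y * (4 * G) + (2 * (Y * G) + Y * G) + 2 * (Y * G) ≡ 9 * (Y * G)
  collect = solve-∀

-- The rounded-down `log (2k)` meets both demands: it is a lower bound for `log₂ (2 * k)`, and it
-- has enough bits for `suc k` in `size-bound`.
logarithm : ∀ k → 1 ≤ k → ∃[ l ] (1 ≤ l × 2 ^ l ≤ 2 * k × k < 2 ^ l)
logarithm k 1≤k with last-below (λ i → 2 ^ i ℕ.≤? 2 * k) (ℕP.*-mono-≤ (s≤s (z≤n {1})) 1≤k) (2 * k) (ℕP.<⇒≱ (n<2^n (2 * k)))
... | zero  , _  , ¬P = contradiction (ℕP.*-monoʳ-≤ 2 1≤k) ¬P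
... | suc l , Pl , ¬P = suc l , s≤s z≤n , Pl , ℕP.*-cancelˡ-< 2 k _ (ℕP.≰⇒> ¬P)

-- b ≤ D² b ≤ k l < 4 D² b is the range in which D = √(kl/b), up to a factor of 2, nearly
-- minimizes l(k/D) + Db.
exponent : ∀ {C : ℕ → Set} k b → 1 ≤ k → 1 ≤ b → C k →
  (∀ D l .{{_ : NonZero D}} → suc k ≤ 2 ^ l → ∃[ q ] (D * q ≤ k × C (l * q + D * b))) →
  ∃[ z ] ∃[ l ] (C z × 1 ≤ z × 1 ≤ l × 2 ^ l ≤ 2 * k × z * z < 9 * b * (k * l))
exponent {C} k b 1≤k 1≤b few many with l , 1≤l , 2^l≤2k , k<2^l ← logarithm k 1≤k with b ℕ.≤? k * l
-- Here `√(kl/b) < 1`, and one bit for each colour is cheap enough: `k² ≤ (kl)² < b k l`.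
... | no b≰Y = k , l , few , 1≤k , 1≤l , 2^l≤2k , (begin-strict
  k * k                ≤⟨ ℕP.*-mono-≤ k≤Y k≤Y ⟩
  k * l * (k * l)      <⟨ ℕP.*-monoˡ-< (k * l) {{ℕ.>-nonZero (ℕP.*-mono-≤ 1≤k 1≤l)}} (ℕP.≰⇒> b≰Y) ⟩
  b * (k * l)          ≤⟨ ℕP.*-monoˡ-≤ (k * l) (ℕP.m≤m+n b (8 * b)) ⟩
  9 * b * (k * l)      ∎)
  where
  open ℕP.≤-Reasoning
  k≤Y : k ≤ k * l
  k≤Y = ℕP.m≤m*n k l {{ℕ.>-nonZero 1≤l}}
... | yes b≤Y with last-below (λ i → i * i * b ℕ.≤? k * l) z≤n (suc (k * l)) too-big
  where
  too-big : ¬ (suc (k * l) * suc (k * l) * b ≤ k * l)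
  too-big le = ℕP.<⇒≱ {k * l} (ℕP.≤-trans (ℕP.m≤m*n (suc (k * l)) (suc (k * l)))
    (ℕP.m≤m*n _ b {{ℕ.>-nonZero 1≤b}})) le
...   | zero , _ , ¬P = contradiction (subst (_≤ k * l) (sym (ℕP.*-identityˡ b)) b≤Y) ¬P
...   | D@(suc D-1) , G≤Y , ¬P with q , Dq≤k , Cz ← many D l k<2^l =
  z , l , Cz , ℕP.≤-trans (ℕP.*-mono-≤ (s≤s (z≤n {D-1})) 1≤b) (ℕP.m≤n+m (D * b) (l * q)) , 1≤l , 2^l≤2k ,
  -- `z D ≤ Y + G`, and `G = D² b` is within a factor 4 of `Y`, so `square-sum` applies after
  -- multiplication by `D²`.
  ℕP.*-cancelʳ-< (D * D) (z * z) (9 * b * Y) (begin-strict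
    z * z * (D * D)               ≡⟨ swap z D ⟩
    z * D * (z * D)               ≤⟨ ℕP.*-mono-≤ zD≤Y+G zD≤Y+G ⟩
    (Y + G) * (Y + G)             <⟨ square-sum Y G 1≤G G≤Y Y≤4G ⟩
    9 * (Y * G)                   ≡⟨ regroup b Y D ⟩
    9 * b * Y * (D * D)           ∎)
  where
  open ℕP.≤-Reasoning
  Y = k * l
  G = D * D * b
  z = l * q + D * b
  1≤G : 1 ≤ G
  1≤G = ℕP.*-mono-≤ (s≤s (z≤n {D-1 + D-1 * suc D-1})) 1≤b
  Y≤4G : Y ≤ 4 * G
  Y≤4G = begin
    Y                              ≤⟨ ℕP.<⇒≤ (ℕP.≰⇒> ¬P) ⟩
    suc D * suc D * b              ≤⟨ ℕP.*-monoˡ-≤ b (ℕP.*-mono-≤ 1+D≤2D 1+D≤2D) ⟩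
    (D + D) * (D + D) * b          ≡⟨ quadruple D b ⟩
    4 * G                          ∎
    where
    1+D≤2D : suc D ≤ D + D
    1+D≤2D = s≤s (ℕP.m≤n+m D D-1)
    quadruple : ∀ D b → (D + D) * (D + D) * b ≡ 4 * (D * D * b)
    quadruple = solve-∀
  zD≤Y+G : z * D ≤ Y + G
  zD≤Y+G = begin
    (l * q + D * b) * D            ≡⟨ distrib l q D b ⟩
    D * q * l + G                  ≤⟨ ℕP.+-monoˡ-≤ G (ℕP.*-monoˡ-≤ l Dq≤k) ⟩
    k * l + G                      ∎
    where
    distrib : ∀ l q D b → (l * q + D * b) * D ≡ D * q * l + D * D * b
    distrib = solve-∀
  swap : ∀ z D → z * z * (D * D) ≡ z * D * (z * D)
  swap = solve-∀
  regroup : ∀ b Y D → 9 * (Y * (D * D * b)) ≡ 9 * b * Y * (D * D)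
  regroup = solve-∀

-- An integer in place of `√b`: `9 b ≤ (3 c)²` keeps the exponent bound, and `c² ≤ 2 b` is why `2 b`
-- has to lie below `(log r)^α`. With `γ = c - 1` the upper bound is `(γ + 1)² ≤ 2 (γ² + 1)`.
root-between : ∀ b → 1 ≤ b → ∃[ c ] (1 ≤ c × b ≤ c * c × c * c ≤ 2 * b)
root-between b 1≤b with γ , γ²<b , ¬P ← last-below (λ i → i * i ℕ.<? b) 1≤b b
    (ℕP.≤⇒≯ (ℕP.m≤m*n b b {{ℕ.>-nonZero 1≤b}}))
  = suc γ , s≤s z≤n , ℕP.≮⇒≥ ¬P , ℕP.≤-trans (double γ) (ℕP.*-monoʳ-≤ 2 γ²<b)
  where
  double : ∀ γ → suc γ * suc γ ≤ 2 * suc (γ * γ)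
  double zero    = s≤s z≤n
  double (suc δ) = subst (suc (suc δ) * suc (suc δ) ≤_) (eq δ) (ℕP.m≤m+n _ (δ * δ))
    where
    eq : ∀ δ → suc (suc δ) * suc (suc δ) + δ * δ ≡ 2 * suc (suc δ * suc δ)
    eq = solve-∀

-- The bound on the chromatic number

module _ {r : ℕ} {α : Cut} {n : ℕ} (G : Graph n) (adj? : ∀ u v → Dec (Adj G u v)) where

  χ-bound-empty : 1 ≤ r → IsReal α → fromℕ 0 <ʳ α → Colourable G 1 →
    χ[ G ]≤ (fromℕ 2 ^ʳ (fromℕ 3 *ʳ log₂ r ^ʳ (α /ʳ 2) *ʳ √ (fromℕ 0 *ʳ log₂ (2 * 0))))
  χ-bound-empty 1≤r real 0<α col =
    let j , χ≡j , j≤1 = chromaticNumber G adj? col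
    in j , χ≡j , ≤-2^0 {r} {α} j 1≤r real 0<α j≤1

  χ-bound-nonempty : ∀ k b → 1 ≤ k → 1 ≤ b → Below r α (2 * b) → Colourable G (2 ^ k) →
    (∀ D l .{{_ : NonZero D}} → suc k ≤ 2 ^ l → ∃[ q ] (D * q ≤ k × Colourable G (2 ^ (l * q + D * b)))) →
    χ[ G ]≤ (fromℕ 2 ^ʳ (fromℕ 3 *ʳ log₂ r ^ʳ (α /ʳ 2) *ʳ √ (fromℕ k *ʳ log₂ (2 * k))))
  χ-bound-nonempty k b 1≤k 1≤b 2b<L^α few many =
    let z , l , col , 1≤z , 1≤l , 2^l≤2k , z²< = exponent {λ z → Colourable G (2 ^ z)} k b 1≤k 1≤b few many
        j , χ≡j , j≤2^z = chromaticNumber G adj? col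
        c , 1≤c , b≤c² , c²≤2b = root-between b 1≤b
        z²<′ = ℕP.<-≤-trans z²< (ℕP.*-monoˡ-≤ (k * l) (subst (9 * b ≤_) (nine c) (ℕP.*-monoʳ-≤ 9 b≤c²)))
    in j , χ≡j , ≤-2^ j z j≤2^z (exponent-lower {r} {α /ʳ 2} c k l z 1≤c 1≤k 1≤l 1≤z 2^l≤2k z²<′
                                   (below⇒root {r} {α} (2 * b) c c²≤2b 2b<L^α))
    where
    nine : ∀ c → 9 * (c * c) ≡ 3 * c * (3 * c)
    nine = solve-∀

module _ {r : ℕ} {α : Cut} {n M : ℕ} (1≤r : 1 ≤ r) (real : IsReal α) (0<α : fromℕ 0 <ʳ α)
  (b′ T′ m : ℕ) .{{_ : NonZero m}} (n≤ : n ≤ (m ^ suc T′) ^ suc b′)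
  (≤M : suc b′ * (suc T′ * (m * 2 ^ suc T′)) ≤ M) (2b<L^α : Below r α (2 * suc b′)) where

  open EdgeColouring n b′ T′ m M n≤ ≤M

  χ-bound : ∀ I → χ[ 𝒢 E I ]≤
    (fromℕ 2 ^ʳ (fromℕ 3 *ʳ log₂ r ^ʳ (α /ʳ 2) *ʳ √ (fromℕ ∣ I ∣ *ʳ log₂ (2 * ∣ I ∣))))
  χ-bound I = subst Bound (length-elements I) (bound (k ℕ.≟ 0))
    where
    open Union I
    Bound : ℕ → Set
    Bound k = χ[ 𝒢 E I ]≤ (fromℕ 2 ^ʳ (fromℕ 3 *ʳ log₂ r ^ʳ (α /ʳ 2) *ʳ √ (fromℕ k *ʳ log₂ (2 * k))))
    bound : Dec (k ≡ 0) → Bound k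
    bound (yes k≡0) = subst Bound (sym k≡0) (χ-bound-empty {r} {α} (𝒢 E I) adj? 1≤r real 0<α
      (subst (λ k → Colourable (𝒢 E I) (2 ^ k)) k≡0 colourable-few))
    bound (no k≢0) = χ-bound-nonempty {r} {α} (𝒢 E I) adj? k (suc b′) (ℕP.n≢0⇒n>0 k≢0) (s≤s z≤n) 2b<L^α
      colourable-few colourable-many

  construction : Σ[ E ∈ (Fin M → Graph n) ] (IsEdgePartition (K n) E × (∀ (I : Subset M) → χ[ 𝒢 E I ]≤
    (fromℕ 2 ^ʳ (fromℕ 3 *ʳ log₂ r ^ʳ (α /ʳ 2) *ʳ √ (fromℕ ∣ I ∣ *ʳ log₂ (2 * ∣ I ∣))))))
  construction = E , E-partition , χ-bound

-- The choice of the dimensions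

fromℕ-real : ∀ m → IsReal (fromℕ m)
fromℕ-real m = record
  { L-inhabited = ℚ.- 1ℚ , ℚP.<-≤-trans (from-yes (ℚ.- 1ℚ ℚP.<? 0ℚ)) (0≤ℕ→ℚ m)
  ; U-inhabited = ℕ→ℚ (suc m) , ℕ→ℚ-mono-< {m} {suc m} ℕP.≤-refl
  ; L-rounded   = λ q → mk⇔ (λ q<m → let s , q<s , s<m = ℚP.<-dense q<m in s , q<s , s<m)
                            (λ (s , q<s , s<m) → ℚP.<-trans q<s s<m)
  ; U-rounded   = λ q → mk⇔ (λ m<q → let s , m<s , s<q = ℚP.<-dense m<q in s , s<q , m<s)
                            (λ (s , s<q , m<s) → ℚP.<-trans m<s s<q)
  ; disjoint    = λ q (q<m , m<q) → ℚP.<-asym q<m m<q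
  ; located     = located
  }
  where
  located : ∀ q s → q <ℚ s → (q <ℚ ℕ→ℚ m) ⊎ (ℕ→ℚ m <ℚ s)
  located q s q<s with q ℚP.<? ℕ→ℚ m
  ... | yes q<m = inj₁ q<m
  ... | no q≮m  = inj₂ (ℚP.≤-<-trans (ℚP.≮⇒≥ q≮m) q<s)

<-square : ∀ {r m} → √ (fromℕ r) <ʳ fromℕ m → r < m * m
<-square {r} {m} (q , (0<q , r<q²) , q<m) = ℕ→ℚ-cancel-< {r} {m * m} (ℚP.<-trans r<q²
  (subst (q *ℚ q <ℚ_) (sym (ℕ→ℚ-* m m)) (*-mono-< (ℚP.<⇒≤ 0<q) (ℚP.<⇒≤ 0<q) q<m q<m)))

-- It fails for `n = 6`, which is where the demand `u ≥ 7` comes from.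
2*n²≤2^n : ∀ {n} → 7 ≤′ n → 2 * (n * n) ≤ 2 ^ n
2*n²≤2^n ≤′-refl = from-yes (98 ℕ.≤? 128)
2*n²≤2^n {suc n} (≤′-step 7≤′n) = ℕP.*-monoʳ-≤ 2 (begin
  suc n * suc n           ≡⟨ eq n ⟩
  n * n + (n + n + 1)     ≤⟨ ℕP.+-monoʳ-≤ (n * n) (ℕP.+-monoʳ-≤ (n + n) (ℕP.≤-trans (s≤s z≤n) 7≤n)) ⟩
  n * n + (n + n + n)     ≡⟨ eq′ n ⟩
  n * n + 3 * n           ≤⟨ ℕP.+-monoʳ-≤ (n * n) (ℕP.*-monoˡ-≤ n (ℕP.≤-trans (from-yes (3 ℕ.≤? 7)) 7≤n)) ⟩
  n * n + n * n           ≡⟨ eq″ n ⟩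
  2 * (n * n)             ≤⟨ 2*n²≤2^n 7≤′n ⟩
  2 ^ n                   ∎)
  where
  open ℕP.≤-Reasoning
  7≤n = ℕP.≤′⇒≤ 7≤′n
  eq : ∀ n → suc n * suc n ≡ n * n + (n + n + 1)
  eq = solve-∀
  eq′ : ∀ n → n * n + (n + n + n) ≡ n * n + 3 * n
  eq′ = solve-∀
  eq″ : ∀ n → n * n + n * n ≡ 2 * (n * n)
  eq″ = solve-∀

-- After division by `b` this is `144 (u + 1)² ≤ 200 u²`; the 200 is the one in the definition of
-- `n`.
scale-bound : ∀ u b → 7 ≤ u → (6 * suc u) ^ 2 * (4 * b) ≤ u * u * b * 200
scale-bound u b 7≤u with w , refl ← ℕP.m≤n⇒∃[o]m+o≡n 7≤u = begin
  6 * (8 + w) * (6 * (8 + w) * 1) * (4 * b)    ≤⟨ ℕP.m≤m+n _ (b * (584 + 496 * w + 56 * (w * w))) ⟩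
  6 * (8 + w) * (6 * (8 + w) * 1) * (4 * b) + b * (584 + 496 * w + 56 * (w * w))  ≡⟨ eq w b ⟩
  (7 + w) * (7 + w) * b * 200                  ∎
  where
  open ℕP.≤-Reasoning
  eq : ∀ w b → 6 * (8 + w) * (6 * (8 + w) * 1) * (4 * b) + b * (584 + 496 * w + 56 * (w * w))
    ≡ (7 + w) * (7 + w) * b * 200
  eq = solve-∀

-- 2^(u²) words of length u over 2^u letters: u is the largest with 2^(6u) ≤ r, and n determines
-- the number b of blocks as the least one with n ≤ 2^(u² b).
module Dimensions {r : ℕ} {α : Cut} {n : ℕ} (1≤r : 1 ≤ r) (0<α : fromℕ 0 <ʳ α) (α≤1 : α ≤ʳ fromℕ 1)
  (42<L^α : Below r α 42)
  (n≤ : fromℕ n ≤ʳ (fromℕ 2 ^ʳ (log₂ r ^ʳ (fromℕ 2 +ʳ α) /ʳ 200))) where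

  -- There are at most `A³` codes with `A = 2 ^ u`, and `A³ ≤ √r` amounts to `2 ^ (6 * u) ≤ r`.
  scale : ∃[ u ] (2 ^ (6 * u) ≤ r × ¬ 2 ^ (6 * suc u) ≤ r)
  scale = last-below (λ i → 2 ^ (6 * i) ℕ.≤? r)
    1≤r r
    (ℕP.<⇒≱ (ℕP.<-≤-trans (n<2^n r) (ℕP.^-monoʳ-≤ 2 (ℕP.m≤n*m r 6))))

  u : ℕ
  u = proj₁ scale

  V : ℕ
  V = 6 * suc u

  r<2^V : r < 2 ^ V
  r<2^V = ℕP.≰⇒> (proj₂ (proj₂ scale))

  below⇒<V : ∀ c → Below r α c → c < V
  below⇒<V c c<L^α = 2^-cancel-< {c} {V} (ℕP.<-trans (below⇒2^< {r} {α} {c} α≤1 c<L^α) r<2^V)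

  7≤u : 7 ≤ u
  7≤u = ℕP.≤-pred (ℕP.*-cancelˡ-< 6 7 (suc u) (below⇒<V 42 42<L^α))

  1≤u² : 1 ≤ u * u
  1≤u² = ℕP.*-mono-≤ (ℕP.≤-trans (s≤s z≤n) 7≤u) (ℕP.≤-trans (s≤s z≤n) 7≤u)

  -- The disjunct `b ≡ 0` lets the search start also when `n ≤ 1`. The number of blocks is the
  -- successor of the `b` found.
  blocks : ∃[ b ] ((b ≡ 0 ⊎ 2 ^ (u * u * b) < n) × ¬ (suc b ≡ 0 ⊎ 2 ^ (u * u * suc b) < n))
  blocks = last-below (λ i → (i ℕ.≟ 0) ⊎-dec (2 ^ (u * u * i) ℕ.<? n)) (inj₁ refl) (suc n) λ
    { (inj₂ lt) → ℕP.<-asym lt (ℕP.<-≤-trans (n<2^n n)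
        (ℕP.^-monoʳ-≤ 2 (ℕP.≤-trans (ℕP.n≤1+n n) (ℕP.m≤n*m (suc n) (u * u) {{ℕ.>-nonZero 1≤u²}})))) }

  b′ : ℕ
  b′ = proj₁ blocks

  n≤2^u²b : n ≤ 2 ^ (u * u * suc b′)
  n≤2^u²b = ℕP.≮⇒≥ (proj₂ (proj₂ blocks) ∘ inj₂)

  -- If `b ≥ 1` blocks are too few, the size of `n` yields `4 b < (log r)^α`, and as `α ≤ 1`, also
  -- `4 b < V = 6 (u + 1)`. The factor 4 leaves room for passing from `b` to `suc b`.
  block-bounds : ∀ b → b ≡ 0 ⊎ 2 ^ (u * u * b) < n → Below r α (2 * suc b) × suc b ≤ 2 * u
  block-bounds zero _ = below-mono {r} {α} {2} {42} (s≤s (s≤s z≤n)) 42<L^α ,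
    ℕP.*-mono-≤ (s≤s (z≤n {1})) (ℕP.≤-trans (s≤s z≤n) 7≤u)
  block-bounds b@(suc c) (inj₂ 2^<n) =
    below-mono {r} {α} {2 * suc b} {4 * b} 2b+2≤4b 4b<L^α , ℕP.*-cancelˡ-≤ 4 4b+4≤8u
    where
    open ℕP.≤-Reasoning
    4b<L^α : Below r α (4 * b)
    4b<L^α = size⇒below {r} {α} V (u * u * b) (4 * b) 0<α r<2^V (ℕP.*-mono-≤ 1≤u² (s≤s (z≤n {c})))
      (scale-bound u b 7≤u) (n≤ (ℕ→ℚ (2 ^ (u * u * b))) (ℕ→ℚ-mono-< {2 ^ (u * u * b)} {n} 2^<n))
    2b+2≤4b : 2 * suc b ≤ 4 * b
    2b+2≤4b = begin
      2 * suc b              ≤⟨ ℕP.m≤m+n _ (2 * c) ⟩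
      2 * suc b + 2 * c      ≡⟨ eq c ⟩
      4 * b                  ∎
      where
      eq : ∀ c → 2 * (2 + c) + 2 * c ≡ 4 * (1 + c)
      eq = solve-∀
    4b+4≤8u : 4 * suc b ≤ 4 * (2 * u)
    4b+4≤8u = begin
      4 * suc b              ≡⟨ ℕP.*-suc 4 b ⟩
      4 + 4 * b              ≤⟨ ℕP.+-monoʳ-≤ 4 (ℕP.<⇒≤ (below⇒<V (4 * b) 4b<L^α)) ⟩
      4 + 6 * suc u          ≡⟨ eq u ⟩
      10 + 6 * u             ≤⟨ ℕP.+-monoˡ-≤ (6 * u) (ℕP.≤-trans (from-yes (10 ℕ.≤? 14)) (ℕP.*-monoʳ-≤ 2 7≤u)) ⟩
      2 * u + 6 * u          ≡⟨ eq′ u ⟩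
      4 * (2 * u)            ∎
      where
      eq : ∀ u → 4 + 6 * suc u ≡ 10 + 6 * u
      eq = solve-∀
      eq′ : ∀ u → 2 * u + 6 * u ≡ 4 * (2 * u)
      eq′ = solve-∀

  2b<L^α : Below r α (2 * suc b′)
  2b<L^α = proj₁ (block-bounds b′ (proj₁ (proj₂ blocks)))

  n≤words : n ≤ ((2 ^ u) ^ u) ^ suc b′
  n≤words = subst (n ≤_) (sym (trans (cong (_^ suc b′) (ℕP.^-*-assoc 2 u u)) (ℕP.^-*-assoc 2 (u * u) (suc b′)))) n≤2^u²b

  -- Letters and vectors contribute a factor `A` each, and `suc b′ * u ≤ 2 u² ≤ A` is the third;
  -- then `A⁶ ≤ r < (M + 1)²`.
  colours : ∀ {M} → √ (fromℕ r) <ʳ fromℕ (suc M) → suc b′ * (u * (2 ^ u * 2 ^ u)) ≤ M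
  colours {M} √r< = ℕP.≤-trans count (ℕP.≤-pred (square-cancel-< (begin-strict
    A * A * A * (A * A * A)     ≡⟨ sixth A ⟩
    A ^ 6                       ≡⟨ trans (ℕP.^-*-assoc 2 u 6) (cong (2 ^_) (ℕP.*-comm u 6)) ⟩
    2 ^ (6 * u)                 ≤⟨ proj₁ (proj₂ scale) ⟩
    r                           <⟨ <-square {r} {suc M} √r< ⟩
    suc M * suc M               ∎)))
    where
    open ℕP.≤-Reasoning
    A = 2 ^ u
    2u²≤A : 2 * (u * u) ≤ A
    2u²≤A = 2*n²≤2^n (ℕP.≤⇒≤′ 7≤u)
    count : suc b′ * (u * (A * A)) ≤ A * A * A
    count = begin
      suc b′ * (u * (A * A))      ≤⟨ ℕP.*-monoˡ-≤ (u * (A * A)) (proj₂ (block-bounds b′ (proj₁ (proj₂ blocks)))) ⟩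
      2 * u * (u * (A * A))       ≡⟨ eq u A ⟩
      2 * (u * u) * (A * A)       ≤⟨ ℕP.*-monoˡ-≤ (A * A) 2u²≤A ⟩
      A * (A * A)                 ≡⟨ ℕP.*-assoc A A A ⟨
      A * A * A                   ∎
      where
      eq : ∀ u A → 2 * u * (u * (A * A)) ≡ 2 * (u * u) * (A * A)
      eq = solve-∀
    sixth : ∀ A → A * A * A * (A * A * A) ≡ A * (A * (A * (A * (A * (A * 1)))))
    sixth = solve-∀

-- With `u` a variable it can be matched as `suc T′`, the form of the word length that
-- `EdgeColouring` takes.
words-and-colours : ∀ {r α n M} → 1 ≤ r → IsReal α → fromℕ 0 <ʳ α → ∀ u b′ → 1 ≤ u →
  n ≤ ((2 ^ u) ^ u) ^ suc b′ → suc b′ * (u * (2 ^ u * 2 ^ u)) ≤ M → Below r α (2 * suc b′) →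
  Σ[ E ∈ (Fin M → Graph n) ] (IsEdgePartition (K n) E × (∀ (I : Subset M) → χ[ 𝒢 E I ]≤
    (fromℕ 2 ^ʳ (fromℕ 3 *ʳ log₂ r ^ʳ (α /ʳ 2) *ʳ √ (fromℕ ∣ I ∣ *ʳ log₂ (2 * ∣ I ∣))))))
words-and-colours {r} {α} 1≤r real 0<α (suc T′) b′ _ n≤ ≤M =
  construction {r} {α} 1≤r real 0<α b′ T′ (2 ^ suc T′) {{ℕP.m^n≢0 2 (suc T′)}} n≤ ≤M

theorem3p3 : Σ[ r₀ ∈ Cut ] (IsReal r₀ × fromℕ 0 <ʳ r₀ ×
    (∀ (r : ℕ) → 1 ≤ r →
    ∀ (α : Cut) → IsReal α → fromℕ 0 <ʳ α → α ≤ʳ fromℕ 1 →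
    r₀ ≤ʳ log₂ r ^ʳ α →
    ∀ (n : ℕ) → IsFloor (fromℕ 2 ^ʳ (log₂ r ^ʳ (fromℕ 2 +ʳ α) /ʳ 200)) n →
    ∀ (m : ℕ) → IsFloor (√ (fromℕ r)) m →
    Σ[ E ∈ (Fin m → Graph n) ] (IsEdgePartition (K n) E ×
    (∀ (I : Subset m) →
    χ[ 𝒢 E I ]≤
    fromℕ 2 ^ʳ (fromℕ 3 *ʳ log₂ r ^ʳ (α /ʳ 2)
    *ʳ √ (fromℕ ∣ I ∣ *ʳ log₂ (2 * ∣ I ∣)))))))
theorem3p3 = fromℕ 43 , fromℕ-real 43 , (1ℚ , 0<1 , ℕ→ℚ-mono-< {1} {43} (s≤s (s≤s z≤n))) , construct
  where
  construct : ∀ r → 1 ≤ r → ∀ α → IsReal α → fromℕ 0 <ʳ α → α ≤ʳ fromℕ 1 → fromℕ 43 ≤ʳ log₂ r ^ʳ α →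
    ∀ n → IsFloor (fromℕ 2 ^ʳ (log₂ r ^ʳ (fromℕ 2 +ʳ α) /ʳ 200)) n → ∀ m → IsFloor (√ (fromℕ r)) m →
    Σ[ E ∈ (Fin m → Graph n) ] (IsEdgePartition (K n) E × (∀ (I : Subset m) → χ[ 𝒢 E I ]≤
      (fromℕ 2 ^ʳ (fromℕ 3 *ʳ log₂ r ^ʳ (α /ʳ 2) *ʳ √ (fromℕ ∣ I ∣ *ʳ log₂ (2 * ∣ I ∣))))))
  construct r 1≤r α real 0<α α≤1 43≤ n (n≤ , _) m (_ , √r<) =
    words-and-colours {r} {α} 1≤r real 0<α u b′ (ℕP.≤-trans (s≤s z≤n) 7≤u) n≤words (colours √r<) 2b<L^α
    where
    -- `Below` is strict, so 42 needs `r₀ = 43`; and 42 is `6 * 7`, which yields `u ≥ 7`.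
    open Dimensions {r} {α} {n} 1≤r 0<α α≤1
      (power⇒below {r} {α} 42 (s≤s z≤n) (43≤ (ℕ→ℚ 42) (ℕ→ℚ-mono-< {42} {43} ℕP.≤-refl))) n≤
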